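{- Let $n\ge 2$, $a_1,\ldots,a_{n-1}$ nonnegative integers with at least one $a_i=0$, and $\lambda=\sum a_i\omega_i$. A point $v\in U$ is a vertex of $P_\lambda$ if and only if $v=\sum_{i=1}^{n-1}a_i\chi_{A_i}$ for some nice tuple $(A_1,\ldots,A_{n-1})$.
   Context: Let $U=\mathbb R^{\binom n2}$ with coordinates $x_{i,j}$, $1\le i<j\le n$. A Dyck path is a sequence $d=((i_1,j_1),\ldots,(i_N,j_N))$ of pairs with $1\le i_k<j_k\le n$, $j_1-i_1=j_N-i_N=1$, and each $(i_{k+1},j_{k+1})$ equal to $(i_k+1,j_k)$ or $(i_k,j_k+1)$. For $\mu=\sum b_i\omega_i$ with $b_i\ge 0$ integers put $S(x,d)=\sum_{(i,j)\in d}x_{i,j}$, $M(\mu,d)=b_{i_1}+b_{i_1+1}+\ldots+b_{i_N}$ and $P_\mu=\{x\in U: x\ge 0,\ S(x,d)\le M(\mu,d)\ \forall d\}$. Order pairs by $(i_1,j_1)\preceq(i_2,j_2)$ iff $i_1\le i_2$ and $j_1\le j_2$. Let $Q_i=\{(k,l):1\le k\le i,\ i+1\le l\le n\}$. For a set $A$ of pairs, $\chi_A\in U$ is its indicator function. A tuple $(A_1,\ldots,A_{n-1})$ with each $A_i\subset Q_i$ a $\preceq$-antichain is called nice if for every $\lambda'=\sum a'_i\omega_i$ with all $a'_i$ positive integers the point $\sum a'_i\chi_{A_i}$ is a vertex of $P_{\lambda'}$.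
   Formalization: The space U is taken over the rational numbers instead of the reals: the point v, the points of P_λ and the segments used to define vertices (also in the definition of nice) are all rational. -}

module Defs where

open import Data.Nat using (ℕ; zero; suc; _≤_; _<_; _∸_) renaming (_+_ to _+ℕ_; _*_ to _*ℕ_)
import Data.Nat as ℕ
open import Data.Integer using (+_)
open import Data.Rational using (ℚ; _/_; 0ℚ; 1ℚ; _+_; _*_; _-_) renaming (_≤_ to _≤ℚ_; _<_ to _<ℚ_)
open import Data.List using (List; []; _∷_; head; last; map; upTo; foldr)
open import Data.Bool.ListAction using (any)
open import Data.List.Relation.Unary.All using (All)
open import Data.List.Relation.Unary.Linked using (Linked)
open import Data.List.Membership.Propositional using (_∈_)
open import Data.Maybe using (Maybe; just; nothing)
open import Data.Product using (Σ; ∃; _×_; _,_; proj₁; proj₂)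
open import Data.Sum using (_⊎_)
open import Data.Bool using (Bool; true; false; if_then_else_; _∧_)
open import Relation.Binary.PropositionalEquality using (_≡_)
open import Relation.Nullary.Decidable using (⌊_⌋)

ℕ→ℚ : ℕ → ℚ
ℕ→ℚ m = + m / 1

-- A pair (i , j); we use the paper's 1-based conventions.
Pair : Set
Pair = ℕ × ℕ

-- Valid coordinate index of U = ℝ^(n choose 2):  1 ≤ i < j ≤ n
ValidPair : ℕ → Pair → Set
ValidPair n (i , j) = 1 ≤ i × i < j × j ≤ n

-- Points of U: functions on pairs; only values at valid pairs matter.
Point : Set
Point = ℕ → ℕ → ℚ

_≈[_]_ : Point → ℕ → Point → Set
x ≈[ n ] y = ∀ i j → ValidPair n (i , j) → x i j ≡ y i j

Step : Pair → Pair → Set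
Step (i , j) (i' , j') = (i' ≡ suc i × j' ≡ j) ⊎ (i' ≡ i × j' ≡ suc j)

Diag : Pair → Set
Diag (i , j) = j ≡ suc i

IsDyck : ℕ → List Pair → Set
IsDyck n d =
  (∃ λ p → head d ≡ just p × Diag p) ×
  (∃ λ q → last d ≡ just q × Diag q) ×
  All (ValidPair n) d ×
  Linked Step d

S : Point → List Pair → ℚ
S x d = foldr (λ p s → x (proj₁ p) (proj₂ p) + s) 0ℚ d

-- Σ_{k = i}^{m} b k   (zero if m < i)
sumFromTo : (ℕ → ℕ) → ℕ → ℕ → ℕ
sumFromTo b i m = foldr _+ℕ_ 0 (map (λ t → b (i +ℕ t)) (upTo (suc m ∸ i)))

lastFst : Pair → List Pair → ℕ
lastFst p [] = proj₁ p
lastFst p (q ∷ qs) = lastFst q qs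

M : (ℕ → ℕ) → List Pair → ℕ
M b [] = 0
M b (p ∷ ps) = sumFromTo b (proj₁ p) (lastFst p ps)

-- The polytope P_μ for μ = Σ b_i ω_i (b given as a function, only b_1..b_{n-1} used)
InP : ℕ → (ℕ → ℕ) → Point → Set
InP n b x =
  (∀ i j → ValidPair n (i , j) → 0ℚ ≤ℚ x i j) ×
  (∀ d → IsDyck n d → S x d ≤ℚ ℕ→ℚ (M b d))

convex : ℚ → Point → Point → Point
convex t p q i j = t * p i j + (1ℚ - t) * q i j

IsVertex : ℕ → (ℕ → ℕ) → Point → Set
IsVertex n b v =
  InP n b v ×
  (∀ p q t → InP n b p → InP n b q → 0ℚ <ℚ t → t <ℚ 1ℚ →
     v ≈[ n ] convex t p q → p ≈[ n ] q)

_⪯_ : Pair → Pair → Set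
(i₁ , j₁) ⪯ (i₂ , j₂) = i₁ ≤ i₂ × j₁ ≤ j₂

InQ : ℕ → ℕ → Pair → Set
InQ n i (k , l) = 1 ≤ k × k ≤ i × suc i ≤ l × l ≤ n

-- Finite sets of pairs are represented by lists.
Antichain : List Pair → Set
Antichain A = ∀ p q → p ∈ A → q ∈ A → p ⪯ q → p ≡ q

χ : List Pair → ℕ → ℕ → ℕ
χ A k l = if any (λ p → ⌊ proj₁ p ℕ.≟ k ⌋ ∧ ⌊ proj₂ p ℕ.≟ l ⌋) A then 1 else 0

combo : ℕ → (ℕ → ℕ) → (ℕ → List Pair) → Point
combo n a A k l = ℕ→ℚ (sumFromTo (λ i → a i *ℕ χ (A i) k l) 1 (n ∸ 1))

-- A tuple (A_1, …, A_{n-1}) (given as a function; only indices 1..n-1 matter) is nice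
Nice : ℕ → (ℕ → List Pair) → Set
Nice n A =
  (∀ i → 1 ≤ i → i ≤ n ∸ 1 → All (InQ n i) (A i) × Antichain (A i)) ×
  (∀ (a' : ℕ → ℕ) → (∀ i → 1 ≤ i → i ≤ n ∸ 1 → 1 ≤ a' i) →
     IsVertex n a' (combo n a' A))

{-# OPTIONS --safe #-}
-- The heart of the matter is that every x ∈ P_λ is a positive combination of indicators of antichains,
-- with total weight a_i for the antichains in Q_i. After clearing denominators let Y(k,l) be the
-- largest value of a_1 + … + a_{i-1} + S(x, d) over the paths d from some (i, i+1) to (k, l), and let
-- Z(k,l) = Y(k,l) − x(k,l). For a threshold θ with a_1 + … + a_{i-1} < θ ≤ a_1 + … + a_i the set
-- { Z < θ ≤ Y } is an antichain in Q_i, and x is the sum of these sets over all θ.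
--
-- A vertex v of P_λ is the only maximiser of some linear functional c, namely the sum of the
-- inequalities that are tight at v. Let A_i maximise c among the antichains in Q_i, ties being broken
-- lexicographically by the coordinates. By the decomposition, Σ a'_i χ_{A_i} is a vertex of P_λ' for
-- all λ', and Σ a_i χ_{A_i} maximises c on P_λ, hence equals v.
module Submission where

open import Defs

module ExposedPoints where
  open import Data.Nat using (ℕ; suc; z≤n; s≤s)
  import Data.Nat as ℕ
  import Data.Nat.Properties as ℕₚ
  open import Data.Integer using (-[1+_])
  import Data.Integer as ℤ
  import Data.Integer.Properties as ℤₚ
  open import Data.Rational using (ℚ; mkℚ; 0ℚ; 1ℚ; _+_; _*_; _-_; -_; 1/_; _⊓_; _≤_; _<_; positive; nonNegative; toℚᵘ; *≤*)
  open import Data.Rational.Properties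
  open import Data.Rational.Solver using (module +-*-Solver)
  import Data.Rational.Unnormalised as ℚᵘ
  import Data.Rational.Unnormalised.Properties as ℚᵘₚ
  open import Data.List using (List; []; _∷_)
  open import Data.List.Relation.Unary.All as All using (All; []; _∷_)
  open import Data.Product using (∃; _×_; _,_; proj₁; proj₂)
  open import Data.Sum using (inj₁; inj₂)
  open import Relation.Binary using (tri<; tri≈; tri>)
  open import Relation.Nullary using (yes; no; contradiction)
  open import Relation.Binary.PropositionalEquality using (_≡_; refl; sym; trans; cong; cong₂; subst; subst₂)

  private
    variable
      n : ℕ

  -- Natural numbers inside ℚ, and rational arithmetic.

  ℕ→ℚ-toℚᵘ : ∀ m → toℚᵘ (ℕ→ℚ m) ℚᵘ.≃ ℚᵘ.mkℚᵘ (ℤ.+ m) 0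
  ℕ→ℚ-toℚᵘ m = toℚᵘ-fromℚᵘ (ℚᵘ.mkℚᵘ (ℤ.+ m) 0)

  ℕ→ℚ-+ : ∀ m k → ℕ→ℚ (m ℕ.+ k) ≡ ℕ→ℚ m + ℕ→ℚ k
  ℕ→ℚ-+ m k = toℚᵘ-injective
    (ℚᵘₚ.≃-trans (ℕ→ℚ-toℚᵘ (m ℕ.+ k)) (ℚᵘₚ.≃-sym
    (ℚᵘₚ.≃-trans (toℚᵘ-homo-+ (ℕ→ℚ m) (ℕ→ℚ k))
    (ℚᵘₚ.≃-trans (ℚᵘₚ.+-cong (ℕ→ℚ-toℚᵘ m) (ℕ→ℚ-toℚᵘ k))
    (ℚᵘ.*≡* (cong (ℤ._* (ℤ.+ 1)) (cong₂ ℤ._+_ (ℤₚ.*-identityʳ (ℤ.+ m)) (ℤₚ.*-identityʳ (ℤ.+ k)))))))))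

  ℕ→ℚ-* : ∀ m k → ℕ→ℚ (m ℕ.* k) ≡ ℕ→ℚ m * ℕ→ℚ k
  ℕ→ℚ-* m k = toℚᵘ-injective
    (ℚᵘₚ.≃-trans (ℕ→ℚ-toℚᵘ (m ℕ.* k)) (ℚᵘₚ.≃-sym
    (ℚᵘₚ.≃-trans (toℚᵘ-homo-* (ℕ→ℚ m) (ℕ→ℚ k))
    (ℚᵘₚ.≃-trans (ℚᵘₚ.*-cong (ℕ→ℚ-toℚᵘ m) (ℕ→ℚ-toℚᵘ k))
    (ℚᵘ.*≡* (cong (ℤ._* (ℤ.+ 1)) (sym (ℤₚ.pos-* m k))))))))

  ℕ→ℚ-mono-≤ : ∀ {m k} → m ℕ.≤ k → ℕ→ℚ m ≤ ℕ→ℚ k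
  ℕ→ℚ-mono-≤ {m} {k} m≤k = toℚᵘ-cancel-≤
    (ℚᵘₚ.≤-respʳ-≃ (ℚᵘₚ.≃-sym (ℕ→ℚ-toℚᵘ k)) (ℚᵘₚ.≤-respˡ-≃ (ℚᵘₚ.≃-sym (ℕ→ℚ-toℚᵘ m))
    (ℚᵘ.*≤* (ℤₚ.*-monoʳ-≤-nonNeg (ℤ.+ 1) (ℤ.+≤+ m≤k)))))

  ℕ→ℚ-cancel-≤ : ∀ {m k} → ℕ→ℚ m ≤ ℕ→ℚ k → m ℕ.≤ k
  ℕ→ℚ-cancel-≤ {m} {k} p = ℤₚ.drop‿+≤+
    (subst₂ ℤ._≤_ (ℤₚ.*-identityʳ (ℤ.+ m)) (ℤₚ.*-identityʳ (ℤ.+ k))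
    (ℚᵘₚ.drop-*≤* (ℚᵘₚ.≤-respʳ-≃ (ℕ→ℚ-toℚᵘ k) (ℚᵘₚ.≤-respˡ-≃ (ℕ→ℚ-toℚᵘ m) (toℚᵘ-mono-≤ p)))))

  ℕ→ℚ-nonNeg : ∀ m → 0ℚ ≤ ℕ→ℚ m
  ℕ→ℚ-nonNeg m = ℕ→ℚ-mono-≤ {0} {m} z≤n

  ℕ→ℚ-pos : ∀ m → 0ℚ < ℕ→ℚ (suc m)
  ℕ→ℚ-pos m = <-≤-trans (positive⁻¹ 1ℚ) (ℕ→ℚ-mono-≤ {1} {suc m} (s≤s z≤n))

  clear-denominator : ∀ q → 0ℚ ≤ q → ∃ λ D → ∃ λ m → ℕ→ℚ (suc D) * q ≡ ℕ→ℚ m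
  clear-denominator q@(mkℚ (ℤ.+ m) d _) _ = d , m , toℚᵘ-injective
    (ℚᵘₚ.≃-trans (toℚᵘ-homo-* (ℕ→ℚ (suc d)) q)
    (ℚᵘₚ.≃-trans (ℚᵘₚ.*-cong (ℕ→ℚ-toℚᵘ (suc d)) (ℚᵘₚ.≃-refl {toℚᵘ q}))
    (ℚᵘₚ.≃-trans (ℚᵘ.*≡* eq) (ℚᵘₚ.≃-sym (ℕ→ℚ-toℚᵘ m)))))
    where
    eq : ((ℤ.+ suc d) ℤ.* (ℤ.+ m)) ℤ.* (ℤ.+ 1) ≡ (ℤ.+ m) ℤ.* (ℤ.+ (1 ℕ.* suc d))
    eq = trans (ℤₚ.*-identityʳ _) (trans (ℤₚ.*-comm (ℤ.+ suc d) (ℤ.+ m))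
      (cong (λ z → (ℤ.+ m) ℤ.* (ℤ.+ z)) (sym (ℕₚ.*-identityˡ (suc d)))))
  clear-denominator (mkℚ -[1+ m ] d _) (*≤* ())

  +-cancelʳ-≤ : ∀ r {p q} → p + r ≤ q + r → p ≤ q
  +-cancelʳ-≤ r {p} {q} le = subst₂ _≤_ (undo p) (undo q) (+-monoˡ-≤ (- r) le)
    where
    undo : ∀ p → p + r + - r ≡ p
    undo p = trans (+-assoc p r (- r)) (trans (cong (p +_) (+-inverseʳ r)) (+-identityʳ p))

  -- A strict gap in the first term could not be made up by the second. Every passage from equality
  -- of a sum to equality of its terms goes through this lemma or its mirror image.
  +-squeezeˡ : ∀ {p q r s} → p ≤ r → q ≤ s → r + s ≤ p + q → p ≡ r
  +-squeezeˡ {p} {s = s} p≤r q≤s le = ≤-antisym p≤r (+-cancelʳ-≤ s (≤-trans le (+-monoʳ-≤ p q≤s)))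

  +-squeezeʳ : ∀ {p q r s} → p ≤ r → q ≤ s → r + s ≤ p + q → q ≡ s
  +-squeezeʳ {p} {q} {r} {s} p≤r q≤s le = +-squeezeˡ q≤s p≤r (subst₂ _≤_ (+-comm r s) (+-comm p q) le)

  module _ where
    open +-*-Solver

    [p-q]+q≡p : ∀ p q → (p - q) + q ≡ p
    [p-q]+q≡p = solve 2 (λ p q → (p :- q) :+ q := p) refl

    convex-idem : ∀ t p → t * p + (1ℚ - t) * p ≡ p
    convex-idem = solve 2 (λ t p → t :* p :+ (con 1ℚ :- t) :* p := p) refl

    lincomb-+ : ∀ s t a b c d → (s * a + t * b) + (s * c + t * d) ≡ s * (a + c) + t * (b + d)
    lincomb-+ = solve 6 (λ s t a b c d → (s :* a :+ t :* b) :+ (s :* c :+ t :* d) := s :* (a :+ c) :+ t :* (b :+ d)) refl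

    lincomb-neg : ∀ s t a b → - (s * a + t * b) ≡ s * (- a) + t * (- b)
    lincomb-neg = solve 4 (λ s t a b → :- (s :* a :+ t :* b) := s :* (:- a) :+ t :* (:- b)) refl

    reflect-scalar : ∀ δ g h → δ * (g - h) + g ≡ (1ℚ + δ) * g + (- δ) * h
    reflect-scalar = solve 3 (λ d g h → d :* (g :- h) :+ g := (con 1ℚ :+ d) :* g :+ (:- d) :* h) refl

    convex-reflect : ∀ u ε a b → (1ℚ - u * (1ℚ + ε)) * b + u * (1ℚ + ε) * a ≡
                                 (1ℚ - u) * b + (1ℚ - (1ℚ - u)) * ((1ℚ + ε) * a + (- ε) * b)
    convex-reflect = solve 4 (λ u e a b → (con 1ℚ :- u :* (con 1ℚ :+ e)) :* b :+ u :* (con 1ℚ :+ e) :* a :=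
                    (con 1ℚ :- u) :* b :+ (con 1ℚ :- (con 1ℚ :- u)) :* ((con 1ℚ :+ e) :* a :+ (:- e) :* b)) refl

    trivial-convex : ∀ a b → a ≡ (1ℚ - 1ℚ) * b + 1ℚ * a
    trivial-convex = solve 2 (λ a b → a := (con 1ℚ :- con 1ℚ) :* b :+ con 1ℚ :* a) refl

    p+pq≡p[1+q] : ∀ p q → p + p * q ≡ p * (1ℚ + q)
    p+pq≡p[1+q] = solve 2 (λ p q → p :+ p :* q := p :* (con 1ℚ :+ q)) refl

  -- Linear functionals and inequalities between rationals.

  lincomb : ℚ → Point → ℚ → Point → Point
  lincomb s x t y i j = s * x i j + t * y i j

  -- Points are functions on all of `ℕ × ℕ`, so dependence on the coordinates of `U` alone has to be
  -- recorded, as `resp`. The two-term form of linearity covers convex combinations, prolonged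
  -- segments, sums and scalings.
  record Functional (n : ℕ) : Set where
    field
      eval : Point → ℚ
      resp : ∀ {x y} → x ≈[ n ] y → eval x ≡ eval y
      lin  : ∀ s x t y → eval (lincomb s x t y) ≡ s * eval x + t * eval y

  open Functional

  zeroF : Functional n
  zeroF .eval _ = 0ℚ
  zeroF .resp _ = refl
  zeroF .lin s x t y = sym (trans (cong₂ _+_ (*-zeroʳ s) (*-zeroʳ t)) (+-identityˡ 0ℚ))

  _+F_ : Functional n → Functional n → Functional n
  (F +F G) .eval x = eval F x + eval G x
  (F +F G) .resp x≈y = cong₂ _+_ (resp F x≈y) (resp G x≈y)
  (F +F G) .lin s x t y = trans (cong₂ _+_ (lin F s x t y) (lin G s x t y))
    (lincomb-+ s t (eval F x) (eval F y) (eval G x) (eval G y))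

  -F_ : Functional n → Functional n
  (-F F) .eval x = - eval F x
  (-F F) .resp x≈y = cong -_ (resp F x≈y)
  (-F F) .lin s x t y = trans (cong -_ (lin F s x t y))
    (lincomb-neg s t (eval F x) (eval F y))

  *-mono-≤ˡ : ∀ {r p q} → 0ℚ ≤ r → p ≤ q → r * p ≤ r * q
  *-mono-≤ˡ {r} 0≤r = *-monoˡ-≤-nonNeg r {{nonNegative 0≤r}}

  *-cancel-≡ : ∀ {r p q} → 0ℚ < r → r * p ≡ r * q → p ≡ q
  *-cancel-≡ {r} 0<r eq = ≤-antisym (*-cancelˡ-≤-pos r {{positive 0<r}} (≤-reflexive eq))
                                    (*-cancelˡ-≤-pos r {{positive 0<r}} (≤-reflexive (sym eq)))

  0<p⇒p⁻¹ : ∀ {p} → 0ℚ < p → ∃ λ q → 0ℚ < q × q * p ≡ 1ℚ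
  0<p⇒p⁻¹ {p} 0<p = (1/ p) {{p≢0}} , positive⁻¹ _ {{1/pos⇒pos p {{positive 0<p}}}} , *-inverseˡ p {{p≢0}}
    where p≢0 = pos⇒nonZero p {{positive 0<p}}

  *-pos : ∀ {p q} → 0ℚ < p → 0ℚ < q → 0ℚ < p * q
  *-pos {p} {q} 0<p 0<q = subst (_< p * q) (*-zeroʳ p) (*-monoʳ-<-pos p {{positive 0<p}} 0<q)

  p<r⇒0<r-p : ∀ {p r} → p < r → 0ℚ < r - p
  p<r⇒0<r-p {p} {r} p<r = subst (_< r - p) (+-inverseʳ p) (+-monoˡ-< (- p) p<r)

  -- The weighted terms `t * a` and `(1ℚ - t) * b` are bounded by `t * m` and `(1ℚ - t) * m`, whose
  -- sum is `m`; so both bounds are attained, and the positive weights cancel.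
  average-of-max : ∀ {t a b m} → 0ℚ < t → t < 1ℚ → a ≤ m → b ≤ m → m ≡ t * a + (1ℚ - t) * b → a ≡ m × b ≡ m
  average-of-max {t} {a} {b} {m} 0<t t<1 a≤m b≤m eq =
    *-cancel-≡ 0<t (+-squeezeˡ ta≤tm ub≤um le) , *-cancel-≡ 0<u (+-squeezeʳ ta≤tm ub≤um le)
    where
    0<u = p<r⇒0<r-p t<1
    ta≤tm = *-mono-≤ˡ (<⇒≤ 0<t) a≤m
    ub≤um = *-mono-≤ˡ (<⇒≤ 0<u) b≤m
    le : t * m + (1ℚ - t) * m ≤ t * a + (1ℚ - t) * b
    le = ≤-reflexive (trans (convex-idem t m) eq)

  -- Extreme points of finite systems of inequalities are exposed.

  Constraint : ℕ → Set
  Constraint n = Functional n × ℚ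

  Sat : List (Constraint n) → Point → Set
  Sat cs x = All (λ (G , b) → eval G x ≤ b) cs

  -- Every tight constraint gets weight one, which gives a functional in the relative interior of
  -- the normal cone at `v`.
  tightSum : Point → List (Constraint n) → Functional n
  tightSum v [] = zeroF
  tightSum v ((G , b) ∷ cs) with eval G v ≟ b
  ... | yes _ = G +F tightSum v cs
  ... | no  _ = tightSum v cs

  tightSum-max : ∀ v {x} (cs : List (Constraint n)) → Sat cs x → eval (tightSum v cs) x ≤ eval (tightSum v cs) v
  tightSum-max v [] [] = ≤-refl
  tightSum-max v ((G , b) ∷ cs) (g ∷ gs) with eval G v ≟ b
  ... | yes refl = +-mono-≤ g (tightSum-max v cs gs)
  ... | no  _    = tightSum-max v cs gs

  -- No summand is larger at `x` than at `v`, so if the total loses nothing at `x`, neither does any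
  -- summand.
  tightSum-tight : ∀ v {x} (cs : List (Constraint n)) → Sat cs x → eval (tightSum v cs) v ≤ eval (tightSum v cs) x →
    All (λ (G , b) → eval G v ≡ b → eval G x ≡ b) cs
  tightSum-tight v [] [] le = []
  tightSum-tight v ((G , b) ∷ cs) (g ∷ gs) le with eval G v ≟ b
  ... | yes refl = (λ _ → +-squeezeˡ g (tightSum-max v cs gs) le) ∷
                   tightSum-tight v cs gs (≤-reflexive (sym (+-squeezeʳ g (tightSum-max v cs gs) le)))
  ... | no  ≢b   = (λ ≡b → contradiction ≡b ≢b) ∷ tightSum-tight v cs gs le

  -- Here `s` is the slack of a constraint and `r` the rate at which a motion uses it up. For
  -- `r ≤ 0` any step length will do; otherwise the slack is positive and `s / r` is the bound.
  small-multiple : ∀ r {s} → 0ℚ ≤ s → (s ≡ 0ℚ → r ≤ 0ℚ) →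
    ∃ λ ε → 0ℚ < ε × (∀ δ → 0ℚ ≤ δ → δ ≤ ε → δ * r ≤ s)
  small-multiple r {s} 0≤s s≡0⇒r≤0 with r ≤? 0ℚ
  ... | yes r≤0 = 1ℚ , positive⁻¹ 1ℚ , λ δ 0≤δ _ → ≤-trans (subst (δ * r ≤_) (*-zeroʳ δ) (*-mono-≤ˡ 0≤δ r≤0)) 0≤s
  ... | no  r≰0 with 0<p⇒p⁻¹ (≰⇒> r≰0)
  ... | u , 0<u , ur≡1 = s * u , *-pos 0<s 0<u , λ δ _ δ≤su →
          ≤-trans (*-monoʳ-≤-nonNeg r {{nonNegative (<⇒≤ (≰⇒> r≰0))}} δ≤su)
                  (≤-reflexive (trans (*-assoc s u r) (trans (cong (s *_) ur≡1) (*-identityʳ s))))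
    where
    0<s : 0ℚ < s
    0<s with <-cmp 0ℚ s
    ... | tri< lt _ _ = lt
    ... | tri≈ _ 0≡s _ = contradiction (s≡0⇒r≤0 (sym 0≡s)) r≰0
    ... | tri> _ _ gt = contradiction (≤-<-trans 0≤s gt) (<-irrefl refl)

  ⊓-pos : ∀ {p q} → 0ℚ < p → 0ℚ < q → 0ℚ < p ⊓ q
  ⊓-pos {p} {q} 0<p 0<q with ⊓-sel p q
  ... | inj₁ eq = subst (0ℚ <_) (sym eq) 0<p
  ... | inj₂ eq = subst (0ℚ <_) (sym eq) 0<q

  reflect : ℚ → Point → Point → Point
  reflect δ v x = lincomb (1ℚ + δ) v (- δ) x

  -- The reflected point is `v + δ (v - x)`. A constraint tight at `v` is constant on the line
  -- through `x` and `v`; a loose one has slack that a short step does not exhaust.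
  reflect-≤ : ∀ {v x} ((G , b) : Constraint n) → eval G v ≤ b → (eval G v ≡ b → eval G x ≡ b) →
    ∃ λ ε → 0ℚ < ε × (∀ δ → 0ℚ ≤ δ → δ ≤ ε → eval G (reflect δ v x) ≤ b)
  reflect-≤ {v = v} {x} (G , b) Gv≤b tight =
    let ε , 0<ε , small = small-multiple (g - h) 0≤b-g flat in
    ε , 0<ε , λ δ 0≤δ δ≤ε → subst₂ _≤_
      (trans (reflect-scalar δ g h) (sym (lin G (1ℚ + δ) v (- δ) x)))
      ([p-q]+q≡p b g)
      (+-monoˡ-≤ g (small δ 0≤δ δ≤ε))
    where
    g = eval G v
    h = eval G x
    0≤b-g : 0ℚ ≤ b - g
    0≤b-g = subst (_≤ b - g) (+-inverseʳ g) (+-monoˡ-≤ (- g) Gv≤b)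
    flat : b - g ≡ 0ℚ → g - h ≤ 0ℚ
    flat eq = ≤-reflexive (trans (cong (λ z → g - z) (trans (tight g≡b) (sym g≡b))) (+-inverseʳ g))
      where
      g≡b : g ≡ b
      g≡b = trans (sym (+-identityˡ g)) (trans (cong (_+ g) (sym eq)) ([p-q]+q≡p b g))

  -- The system is finite, so the minimum of the individual step lengths is positive and serves all
  -- constraints at once.
  reflect-Sat : ∀ {v x} (cs : List (Constraint n)) → Sat cs v →
    All (λ (G , b) → eval G v ≡ b → eval G x ≡ b) cs →
    ∃ λ ε → 0ℚ < ε × (∀ δ → 0ℚ ≤ δ → δ ≤ ε → Sat cs (reflect δ v x))
  reflect-Sat [] [] [] = 1ℚ , positive⁻¹ 1ℚ , λ _ _ _ → []
  reflect-Sat {v = v} {x} (c ∷ cs) (g ∷ gs) (h ∷ hs) =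
    let ε₁ , 0<ε₁ , sat₁ = reflect-≤ {v = v} {x} c g h
        ε₂ , 0<ε₂ , sat₂ = reflect-Sat cs gs hs in
    ε₁ ⊓ ε₂ , ⊓-pos 0<ε₁ 0<ε₂ , λ δ 0≤δ δ≤ε →
      sat₁ δ 0≤δ (≤-trans δ≤ε (p⊓q≤p ε₁ ε₂)) ∷ sat₂ δ 0≤δ (≤-trans δ≤ε (p⊓q≤q ε₁ ε₂))

  Extreme : (Point → Set) → ℕ → Point → Set
  Extreme P n v = ∀ p q t → P p → P q → 0ℚ < t → t < 1ℚ → v ≈[ n ] convex t p q → p ≈[ n ] q

  -- The sum of the constraints that are tight at v exposes v: if x attains the same value, then all of
  -- them are tight at x, so the segment from x to v can be prolonged beyond v inside the polyhedron.
  extreme⇒exposed : ∀ {v} (cs : List (Constraint n)) → Sat cs v → Extreme (Sat cs) n v →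
    ∃ λ F → ∀ x → Sat cs x → eval F v ≤ eval F x → v ≈[ n ] x
  extreme⇒exposed {n} {v} cs sat-v ext = tightSum v cs , exposed
    where
    exposed : ∀ x → Sat cs x → eval (tightSum v cs) v ≤ eval (tightSum v cs) x → v ≈[ n ] x
    exposed x sat-x le i j ij =
      trans (split i j ij) (trans (cong (λ z → t * x i j + (1ℚ - t) * z) (sym (x≈y i j ij))) (convex-idem t (x i j)))
      where
      prolongation = reflect-Sat cs sat-v (tightSum-tight v cs sat-x le)
      ε = proj₁ prolongation
      0<ε = proj₁ (proj₂ prolongation)
      0<1+ε : 0ℚ < 1ℚ + ε
      0<1+ε = <-trans 0<ε (subst (_< 1ℚ + ε) (+-identityˡ ε) (+-monoˡ-< ε (positive⁻¹ 1ℚ)))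
      -- Solving `y = (1 + ε) v - ε x` for `v` gives `v = (1 - u) x + u y` with `u = 1 / (1 + ε)`.
      u = proj₁ (0<p⇒p⁻¹ 0<1+ε)
      0<u = proj₁ (proj₂ (0<p⇒p⁻¹ 0<1+ε))
      u[1+ε]≡1 : u * (1ℚ + ε) ≡ 1ℚ
      u[1+ε]≡1 = proj₂ (proj₂ (0<p⇒p⁻¹ 0<1+ε))
      t = 1ℚ - u
      y = reflect ε v x
      u<1 : u < 1ℚ
      u<1 = subst₂ _<_ (+-identityʳ u) (trans (p+pq≡p[1+q] u ε) u[1+ε]≡1) (+-monoʳ-< u (*-pos 0<u 0<ε))
      t<1 : t < 1ℚ
      t<1 = subst (t <_) (+-identityʳ 1ℚ) (+-monoʳ-< 1ℚ (neg-antimono-< 0<u))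
      split : v ≈[ n ] convex t x y
      split i j _ = trans (trivial-convex (v i j) (x i j))
        (trans (cong (λ z → (1ℚ - z) * x i j + z * v i j) (sym u[1+ε]≡1)) (convex-reflect u ε (v i j) (x i j)))
      x≈y : x ≈[ n ] y
      x≈y = ext x y t sat-x (proj₂ (proj₂ prolongation) ε (<⇒≤ 0<ε) ≤-refl) (p<r⇒0<r-p u<1) t<1 split

module Combinatorics where
  open import Data.Nat using (ℕ; zero; suc; pred; _+_; _*_; _∸_; _⊔_; _⊓_; _≤_; _<_; _≤?_; _<?_; _≟_; z≤n; s≤s; >-nonZero)
  open import Data.Nat.Properties
  open import Data.List using (List; []; _∷_; _++_; head; last; map; filter; upTo; applyUpTo; cartesianProduct; foldr)
  open import Data.List.Relation.Unary.All as All using (All; []; _∷_)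
  import Data.List.Relation.Unary.All.Properties as All
  open import Data.List.Relation.Unary.AllPairs using (AllPairs; []; _∷_)
  open import Data.List.Relation.Unary.Linked as Linked using (Linked; []; [-]; _∷_)
  open import Data.List.Relation.Unary.Linked.Properties using (Linked⇒AllPairs)
  open import Data.List.Relation.Unary.Any using (here; there)
  open import Data.List.Membership.Propositional using (_∈_; _∉_)
  open import Data.List.Membership.Propositional.Properties using (∈-filter⁺; ∈-filter⁻; ∈-map⁺; ∈-++⁺ˡ; ∈-++⁺ʳ; ∈-cartesianProduct⁺; ∈-upTo⁺)
  open import Data.Maybe using (just)
  open import Data.Product using (∃; _×_; _,_; proj₁; proj₂)
  open import Data.Product.Properties using (≡-dec)
  open import Data.Sum using (_⊎_; inj₁; inj₂)
  open import Function using (_∘_; id)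
  open import Relation.Nullary using (Dec; yes; no; ¬_; contradiction; _×-dec_; _→-dec_; map′)
  open import Relation.Unary using (Decidable)
  open import Relation.Binary.PropositionalEquality using (_≡_; _≢_; refl; sym; trans; cong; cong₂; subst; subst₂)

  private
    variable
      n : ℕ

  -- Prefix sums.

  psum : (ℕ → ℕ) → ℕ → ℕ
  psum h zero = 0
  psum h (suc k) = psum h k + h (suc k)

  -- The tail of `applyUpTo f k` is again an `applyUpTo`, of `f ∘ suc`; hence the general `f` in
  -- place of the identity that `upTo` uses.
  psum-foldr : ∀ h (g f : ℕ → ℕ) i k → (∀ t → g (f t) ≡ h (suc (i + t))) →
    psum h i + foldr _+_ 0 (map g (applyUpTo f k)) ≡ psum h (i + k)
  psum-foldr h g f i zero eq = trans (+-identityʳ _) (cong (psum h) (sym (+-identityʳ i)))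
  psum-foldr h g f i (suc k) eq =
    trans (sym (+-assoc (psum h i) (g (f 0)) _))
    (trans (cong (λ z → psum h i + z + foldr _+_ 0 (map g (applyUpTo (f ∘ suc) k)))
      (trans (eq 0) (cong (h ∘ suc) (+-identityʳ i))))
    (trans (psum-foldr h g (f ∘ suc) (suc i) k (λ t → trans (eq (suc t)) (cong (h ∘ suc) (+-suc i t))))
    (cong (psum h) (sym (+-suc i k)))))

  psum-sumFromTo : ∀ h {i m} → i ≤ m → psum h i + sumFromTo h (suc i) m ≡ psum h m
  psum-sumFromTo h {i} {m} i≤m = trans (psum-foldr h _ id i (m ∸ i) (λ _ → refl)) (cong (psum h) (m+[n∸m]≡n i≤m))

  sumFromTo-psum : ∀ h m → sumFromTo h 1 m ≡ psum h m
  sumFromTo-psum h m = psum-sumFromTo h {0} {m} z≤n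

  psum-+ : ∀ g h m → psum (λ i → g i + h i) m ≡ psum g m + psum h m
  psum-+ g h zero = refl
  psum-+ g h (suc m) = trans (cong (_+ (g (suc m) + h (suc m))) (psum-+ g h m))
    (interchange (psum g m) (psum h m) (g (suc m)) (h (suc m)))
    where open import Algebra.Properties.CommutativeSemigroup +-commutativeSemigroup using (interchange)

  psum-* : ∀ c h m → psum (λ i → c * h i) m ≡ c * psum h m
  psum-* c h zero = sym (*-zeroʳ c)
  psum-* c h (suc m) = trans (cong (_+ c * h (suc m)) (psum-* c h m)) (sym (*-distribˡ-+ c (psum h m) (h (suc m))))

  psum-cong : ∀ {g h} m → (∀ i → g i ≡ h i) → psum g m ≡ psum h m
  psum-cong zero eq = refl
  psum-cong (suc m) eq = cong₂ _+_ (psum-cong m eq) (eq (suc m))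

  psum-mono : ∀ h {i j} → i ≤ j → psum h i ≤ psum h j
  psum-mono h {i} i≤j = subst (psum h i ≤_) (psum-sumFromTo h i≤j) (m≤m+n _ _)

  psum-cancel-< : ∀ h {i j} → psum h i < psum h j → i < j
  psum-cancel-< h {i} {j} lt = ≰⇒> λ j≤i → <⇒≱ lt (psum-mono h j≤i)

  psum-zero : ∀ h m → (∀ i → 1 ≤ i → i ≤ m → h i ≡ 0) → psum h m ≡ 0
  psum-zero h zero z = refl
  psum-zero h (suc m) z = cong₂ _+_ (psum-zero h m (λ i 1≤i i≤m → z i 1≤i (m≤n⇒m≤1+n i≤m))) (z (suc m) (s≤s z≤n) ≤-refl)

  psum-window-below : ∀ h a i k → (∀ j → 1 ≤ j → j ≤ i + k → h j ≤ a j) → (∀ j → 1 ≤ j → j ≤ i → h j ≡ 0) →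
    psum a i + psum h (i + k) ≤ psum a (i + k)
  psum-window-below h a i zero h≤a z rewrite +-identityʳ i | psum-zero h i z = ≤-reflexive (+-identityʳ _)
  psum-window-below h a i (suc k) h≤a z rewrite +-suc i k =
    subst (_≤ psum a (i + k) + a (suc (i + k))) (+-assoc (psum a i) (psum h (i + k)) _)
      (+-mono-≤ (psum-window-below h a i k (λ j 1≤j j≤ → h≤a j 1≤j (m≤n⇒m≤1+n j≤)) z) (h≤a _ (s≤s z≤n) ≤-refl))

  psum-window-above : ∀ h e k → (∀ j → e < j → j ≤ e + k → h j ≡ 0) → psum h (e + k) ≡ psum h e
  psum-window-above h e zero z = cong (psum h) (+-identityʳ e)
  psum-window-above h e (suc k) z rewrite +-suc e k =
    trans (cong₂ _+_ (psum-window-above h e k (λ j e<j j≤ → z j e<j (m≤n⇒m≤1+n j≤))) (z _ (s≤s (m≤m+n e k)) ≤-refl)) (+-identityʳ _)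

  -- Only terms with `i < j ≤ e` survive in `psum h m`, and there `a` dominates `h`. The bound
  -- `psum a e - psum a i` is stated additively to avoid truncated subtraction.
  psum-window : ∀ h a {i e m} → i ≤ e → e ≤ m → (∀ j → 1 ≤ j → j ≤ m → h j ≤ a j) →
    (∀ j → 1 ≤ j → j ≤ m → j ≤ i ⊎ e < j → h j ≡ 0) → psum a i + psum h m ≤ psum a e
  psum-window h a {i} {e} {m} i≤e e≤m h≤a z = subst (λ w → psum a i + w ≤ psum a e) (sym above) below
    where
    above : psum h m ≡ psum h e
    above = subst (λ m → psum h m ≡ psum h e) (m+[n∸m]≡n e≤m)
      (psum-window-above h e (m ∸ e) (λ j e<j j≤ → z j (≤-trans (s≤s z≤n) e<j) (subst (j ≤_) (m+[n∸m]≡n e≤m) j≤) (inj₂ e<j)))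
    below : psum a i + psum h e ≤ psum a e
    below = subst (λ e → psum a i + psum h e ≤ psum a e) (m+[n∸m]≡n i≤e)
      (psum-window-below h a i (e ∸ i)
        (λ j 1≤j j≤ → h≤a j 1≤j (≤-trans (subst (j ≤_) (m+[n∸m]≡n i≤e) j≤) e≤m))
        (λ j 1≤j j≤i → z j 1≤j (≤-trans j≤i (≤-trans i≤e e≤m)) (inj₁ j≤i)))

  -- Sums along paths, and indicators.

  SN : (ℕ → ℕ → ℕ) → List Pair → ℕ
  SN N = foldr (λ p s → N (proj₁ p) (proj₂ p) + s) 0

  SN-psum : ∀ (f : ℕ → ℕ → ℕ → ℕ) m d → SN (λ k l → psum (λ i → f i k l) m) d ≡ psum (λ i → SN (f i) d) m
  SN-psum f m [] = sym (psum-zero _ m (λ _ _ _ → refl))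
  SN-psum f m ((k , l) ∷ d) = trans (cong (psum (λ i → f i k l) m +_) (SN-psum f m d)) (sym (psum-+ _ _ m))

  SN-* : ∀ c N d → SN (λ k l → c * N k l) d ≡ c * SN N d
  SN-* c N [] = sym (*-zeroʳ c)
  SN-* c N ((k , l) ∷ d) = trans (cong (c * N k l +_) (SN-* c N d)) (sym (*-distribˡ-+ c (N k l) (SN N d)))

  SN-cong : ∀ {N N′} d → (∀ k l → N k l ≡ N′ k l) → SN N d ≡ SN N′ d
  SN-cong [] eq = refl
  SN-cong (p ∷ d) eq = cong₂ _+_ (eq _ _) (SN-cong d eq)

  χ-∈ : ∀ {A k l} → (k , l) ∈ A → χ A k l ≡ 1
  χ-∈ {(k′ , l′) ∷ A} {k} {l} kl∈ with k′ ≟ k | l′ ≟ l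
  ... | yes _ | yes _ = refl
  χ-∈ {(k′ , l′) ∷ A} (here refl) | yes _ | no l≢ = contradiction refl l≢
  χ-∈ {(k′ , l′) ∷ A} (here refl) | no k≢ | _ = contradiction refl k≢
  χ-∈ {(k′ , l′) ∷ A} (there kl∈) | yes _ | no _ = χ-∈ kl∈
  χ-∈ {(k′ , l′) ∷ A} (there kl∈) | no _ | _ = χ-∈ kl∈

  χ-∉ : ∀ {A k l} → (k , l) ∉ A → χ A k l ≡ 0
  χ-∉ {[]} _ = refl
  χ-∉ {(k′ , l′) ∷ A} {k} {l} kl∉ with k′ ≟ k | l′ ≟ l
  ... | yes refl | yes refl = contradiction (here refl) kl∉
  ... | yes _ | no _ = χ-∉ (kl∉ ∘ there)
  ... | no _ | _ = χ-∉ (kl∉ ∘ there)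

  open import Data.List.Membership.DecPropositional (≡-dec _≟_ _≟_) using (_∈?_)

  -- Paths as chains, and the path inequalities for sums of antichains.

  _≺_ : Pair → Pair → Set
  p ≺ q = p ⪯ q × p ≢ q

  step⇒≺ : ∀ {p q} → Step p q → p ≺ q
  step⇒≺ (inj₁ (refl , refl)) = (n≤1+n _ , ≤-refl) , λ ()
  step⇒≺ (inj₂ (refl , refl)) = (≤-refl , n≤1+n _) , λ ()

  ⪯-trans : ∀ {p q r} → p ⪯ q → q ⪯ r → p ⪯ r
  ⪯-trans (a , b) (c , d) = ≤-trans a c , ≤-trans b d

  ⪯-antisym : ∀ {p q} → p ⪯ q → q ⪯ p → p ≡ q
  ⪯-antisym (a , b) (c , d) = cong₂ _,_ (≤-antisym a c) (≤-antisym b d)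

  ≺-trans : ∀ {p q r} → p ≺ q → q ≺ r → p ≺ r
  ≺-trans (p⪯q , p≢q) (q⪯r , _) = ⪯-trans p⪯q q⪯r , λ { refl → p≢q (⪯-antisym p⪯q q⪯r) }

  SN-χ-avoid : ∀ {A} d → All (_∉ A) d → SN (χ A) d ≡ 0
  SN-χ-avoid [] [] = refl
  SN-χ-avoid {A} (p ∷ d) (p∉ ∷ d∉) = cong₂ _+_ (χ-∉ {A} p∉) (SN-χ-avoid d d∉)

  -- A chain meets an antichain at most once: after a hit, all later points of `d` lie strictly
  -- above a member of `A`.
  SN-χ-antichain : ∀ {A d} → Antichain A → AllPairs _≺_ d → SN (χ A) d ≤ 1
  SN-χ-antichain anti [] = z≤n
  SN-χ-antichain {A} {p ∷ d} anti (p≺ ∷ d≺) with p ∈? A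
  ... | yes p∈ rewrite χ-∈ p∈ | SN-χ-avoid {A} d (All.map (λ (p⪯q , p≢q) q∈ → p≢q (anti _ _ p∈ q∈ p⪯q)) p≺) = ≤-refl
  ... | no p∉ rewrite χ-∉ {A} p∉ = SN-χ-antichain anti d≺

  path-⪯-last : ∀ p ps {q} → Linked Step (p ∷ ps) → last (p ∷ ps) ≡ just q → All (_⪯ q) (p ∷ ps) × lastFst p ps ≡ proj₁ q
  path-⪯-last p [] [-] refl = (≤-refl , ≤-refl) ∷ [] , refl
  path-⪯-last p (p′ ∷ ps) (s ∷ ss) eq with path-⪯-last p′ ps ss eq
  ... | p′⪯ ∷ ps⪯ , e = ⪯-trans (proj₁ (step⇒≺ s)) p′⪯ ∷ p′⪯ ∷ ps⪯ , e

  path-⪰-head : ∀ {p ps} → Linked Step (p ∷ ps) → All (p ⪯_) (p ∷ ps)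
  path-⪰-head {p} ss with Linked⇒AllPairs ≺-trans (Linked.map step⇒≺ ss)
  ... | p≺ ∷ _ = (≤-refl , ≤-refl) ∷ All.map proj₁ p≺

  AntichainIn : ℕ → ℕ → List Pair → Set
  AntichainIn n i A = All (InQ n i) A × Antichain A

  AntichainTuple : ℕ → (ℕ → List Pair) → Set
  AntichainTuple n A = ∀ i → 1 ≤ i → i ≤ n ∸ 1 → AntichainIn n i (A i)

  -- A path from `(s, s+1)` to `(e, e+1)` can meet `A t` only for `s ≤ t ≤ e`, and then at most
  -- once. So it collects at most `a s + … + a e`, which is `M a d`. In the proof `s` is `suc i`, so
  -- that the prefix sum to be split off is `psum a i`.
  dyck-combo-≤ : ∀ n a A → AntichainTuple n A → ∀ d → IsDyck n d →
    SN (λ k l → sumFromTo (λ i → a i * χ (A i) k l) 1 (n ∸ 1)) d ≤ M a d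
  dyck-combo-≤ n a A tuple [] _ = z≤n
  dyck-combo-≤ n a A tuple ((zero , _) ∷ _) (_ , _ , (() , _) ∷ _ , _)
  dyck-combo-≤ n a A tuple d@((suc i , j) ∷ ps) ((_ , refl , refl) , ((e , _) , last≡ , refl) , valid , linked) =
    +-cancelˡ-≤ (psum a i) _ _ (subst₂ (λ s t → psum a i + s ≤ t) (sym lhs) (sym rhs) (psum-window h a i≤e e≤n-1 h≤a h≡0))
    where
    h : ℕ → ℕ
    h t = a t * SN (χ (A t)) d
    lhs : SN (λ k l → sumFromTo (λ i → a i * χ (A i) k l) 1 (n ∸ 1)) d ≡ psum h (n ∸ 1)
    lhs = trans (SN-cong d (λ k l → sumFromTo-psum _ (n ∸ 1)))
      (trans (SN-psum (λ i k l → a i * χ (A i) k l) (n ∸ 1) d) (psum-cong (n ∸ 1) (λ t → SN-* (a t) (χ (A t)) d)))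
    toLast = path-⪯-last (suc i , j) ps linked last≡
    i<e : suc i ≤ e
    i<e = proj₁ (All.head (proj₁ toLast))
    i≤e = <⇒≤ i<e
    rhs : psum a i + M a d ≡ psum a e
    rhs = trans (cong (λ z → psum a i + sumFromTo a (suc i) z) (proj₂ toLast)) (psum-sumFromTo a i≤e)
    last-valid : ∀ p ps {q} → All (ValidPair n) (p ∷ ps) → last (p ∷ ps) ≡ just q → ValidPair n q
    last-valid p [] (v ∷ _) refl = v
    last-valid p (p′ ∷ ps) (_ ∷ vs) eq = last-valid p′ ps vs eq
    e≤n-1 : e ≤ n ∸ 1
    e≤n-1 = ∸-monoˡ-≤ 1 (proj₂ (proj₂ (last-valid _ ps valid last≡)))
    h≤a : ∀ t → 1 ≤ t → t ≤ n ∸ 1 → h t ≤ a t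
    h≤a t 1≤t t≤ = subst (h t ≤_) (*-identityʳ (a t))
      (*-monoʳ-≤ (a t) (SN-χ-antichain (proj₂ (tuple t 1≤t t≤)) (Linked⇒AllPairs ≺-trans (Linked.map step⇒≺ linked))))
    h≡0 : ∀ t → 1 ≤ t → t ≤ n ∸ 1 → t ≤ i ⊎ e < t → h t ≡ 0
    h≡0 t 1≤t t≤ outside = trans
      (cong (a t *_) (SN-χ-avoid d (All.zipWith (avoid outside) (path-⪰-head linked , proj₁ toLast))))
      (*-zeroʳ (a t))
      where
      -- Members `(k , l)` of `A t` satisfy `k ≤ t < l`, whereas points of the path have `i < k` and
      -- `l ≤ e + 1`; for `t` outside the window these clash.
      avoid : t ≤ i ⊎ e < t → ∀ {q} → (suc i , suc (suc i)) ⪯ q × q ⪯ (e , suc e) → q ∉ A t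
      avoid (inj₁ t≤i) ((i<k , _) , _) q∈ with All.lookup (proj₁ (tuple t 1≤t t≤)) q∈
      ... | _ , k≤t , _ = <⇒≱ i<k (≤-trans k≤t t≤i)
      avoid (inj₂ e<t) (_ , (_ , l≤1+e)) q∈ with All.lookup (proj₁ (tuple t 1≤t t≤)) q∈
      ... | _ , _ , t<l , _ = <⇒≱ e<t (≤-pred (≤-trans t<l l≤1+e))

  -- Finite lists of pairs and antichains.

  valid? : ∀ n → Decidable (ValidPair n)
  valid? n (i , j) = 1 ≤? i ×-dec i <? j ×-dec j ≤? n

  allPairs : ℕ → List Pair
  allPairs n = filter (valid? n) (cartesianProduct (upTo (suc n)) (upTo (suc n)))

  ∈-allPairs⁺ : ∀ {p} → ValidPair n p → p ∈ allPairs n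
  ∈-allPairs⁺ {n} v@(_ , i<j , j≤n) =
    ∈-filter⁺ (valid? n) (∈-cartesianProduct⁺ (∈-upTo⁺ (s≤s (≤-trans (<⇒≤ i<j) j≤n))) (∈-upTo⁺ (s≤s j≤n))) v

  ∈-allPairs⁻ : ∀ {p} → p ∈ allPairs n → ValidPair n p
  ∈-allPairs⁻ {n} p∈ = proj₂ (∈-filter⁻ (valid? n) {xs = cartesianProduct (upTo (suc n)) (upTo (suc n))} p∈)

  sublists : ∀ {X : Set} → List X → List (List X)
  sublists [] = [] ∷ []
  sublists (x ∷ xs) = map (x ∷_) (sublists xs) ++ sublists xs

  filter-∈-sublists : ∀ {X : Set} {P : X → Set} (P? : Decidable P) xs → filter P? xs ∈ sublists xs
  filter-∈-sublists P? [] = here refl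
  filter-∈-sublists P? (x ∷ xs) with P? x
  ... | yes _ = ∈-++⁺ˡ (∈-map⁺ (x ∷_) (filter-∈-sublists P? xs))
  ... | no  _ = ∈-++⁺ʳ (map (x ∷_) (sublists xs)) (filter-∈-sublists P? xs)

  antichain? : Decidable Antichain
  antichain? A = map′
    (λ all p q p∈ q∈ → All.lookup (All.lookup all p∈) q∈)
    (λ anti → All.tabulate (λ p∈ → All.tabulate (λ q∈ → anti _ _ p∈ q∈)))
    (All.all? (λ (i , j) → All.all? (λ (k , l) → (i ≤? k ×-dec j ≤? l) →-dec ≡-dec _≟_ _≟_ (i , j) (k , l)) A) A)

  antichainIn? : ∀ n i → Decidable (AntichainIn n i)
  antichainIn? n i A = All.all? (λ (k , l) → 1 ≤? k ×-dec k ≤? i ×-dec suc i ≤? l ×-dec l ≤? n) A ×-dec antichain? A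

  -- Antichains are listed only in the order inherited from `allPairs`. This suffices, since every
  -- layer constructed below is a `filter` of that list.
  antichains : ℕ → ℕ → List (List Pair)
  antichains n i = filter (antichainIn? n i) (sublists (allPairs n))

  -- Cutting an integral point into antichain layers.

  data Tail (n : ℕ) (p : Pair) (ps : List Pair) : Set where
    tail : All (ValidPair n) (p ∷ ps) → Linked Step (p ∷ ps) → (∃ λ q → last (p ∷ ps) ≡ just q × Diag q) → Tail n p ps

  -- Used instead of a `with`, so that values of `Y` can be computed by applying `select-yes` and
  -- `select-no`.
  select : ∀ {P : Set} → Dec P → ℕ → ℕ → ℕ
  select (yes _) x y = x
  select (no _) x y = y

  select-yes : ∀ {P : Set} (P? : Dec P) {x y} → P → select P? x y ≡ x
  select-yes (yes _) p = refl
  select-yes (no ¬p) p = contradiction p ¬p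

  select-no : ∀ {P : Set} (P? : Dec P) {x y} → ¬ P → select P? x y ≡ y
  select-no (yes p) ¬p = contradiction p ¬p
  select-no (no _) ¬p = refl

  total : (ℕ → List Pair → ℕ) → List (ℕ × List Pair) → ℕ
  total f = foldr (λ (i , B) s → f i B + s) 0

  total-++ : ∀ f xs ys → total f (xs ++ ys) ≡ total f xs + total f ys
  total-++ f [] ys = refl
  total-++ f ((i , B) ∷ xs) ys = trans (cong (f i B +_) (total-++ f xs ys)) (sym (+-assoc (f i B) _ _))

  module Layers (n : ℕ) (N : ℕ → ℕ → ℕ) (b : ℕ → ℕ) (N-bound : ∀ d → IsDyck n d → SN N d ≤ M b d) where

    Λ : ℕ → ℕ
    Λ = psum b

    -- A longest-path recursion over the two predecessors of a pair. The value `Λ k` in position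
    -- `(k+1, k+1)` is the initial value of a path that starts at `(k+1, k+2)`, whose left neighbour
    -- this is. Row zero is `0`, which is neutral for the maximum.
    Y : ℕ → ℕ → ℕ
    Y zero l = 0
    Y (suc k) zero = 0
    Y (suc k) (suc l) = select (k <? l) (N (suc k) (suc l) + (Y k (suc l) ⊔ Y (suc k) l)) (Λ k)

    Z : ℕ → ℕ → ℕ
    Z k l = Y (pred k) l ⊔ Y k (pred l)

    Y-diag : ∀ k → Y (suc k) (suc k) ≡ Λ k
    Y-diag k = select-no (k <? k) (<-irrefl refl)

    Y≡N+Z : ∀ {k l} → 1 ≤ k → k < l → Y k l ≡ N k l + Z k l
    Y≡N+Z {suc k} {suc l} _ (s≤s k<l) = select-yes (k <? l) k<l

    Z≤Y : ∀ {k l} → 1 ≤ k → k < l → Z k l ≤ Y k l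
    Z≤Y {k} {l} 1≤k k<l = subst (Z k l ≤_) (sym (Y≡N+Z 1≤k k<l)) (m≤n+m _ _)

    Y-step-right : ∀ {k l} → 1 ≤ k → k ≤ l → Y k l ≤ Y k (suc l)
    Y-step-right {k} {l} 1≤k k≤l = ≤-trans (m≤n⊔m (Y (pred k) (suc l)) (Y k l)) (Z≤Y 1≤k (s≤s k≤l))

    Y-step-down : ∀ {k l} → suc k < l → Y k l ≤ Y (suc k) l
    Y-step-down {k} {l} k<l = ≤-trans (m≤m⊔n (Y k l) (Y (suc k) (pred l))) (Z≤Y (s≤s z≤n) k<l)

    Y-mono-right : ∀ {k l} → 1 ≤ k → k ≤ l → ∀ m → Y k l ≤ Y k (l + m)
    Y-mono-right {k} {l} 1≤k k≤l zero = ≤-reflexive (cong (Y k) (sym (+-identityʳ l)))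
    Y-mono-right {k} {l} 1≤k k≤l (suc m) = ≤-trans (Y-mono-right 1≤k k≤l m)
      (subst (λ z → Y k (l + m) ≤ Y k z) (sym (+-suc l m)) (Y-step-right 1≤k (≤-trans k≤l (m≤m+n l m))))

    Y-mono-down : ∀ {k l} m → k + m < l → Y k l ≤ Y (k + m) l
    Y-mono-down {k} {l} zero _ = ≤-reflexive (cong (λ z → Y z l) (sym (+-identityʳ k)))
    Y-mono-down {k} {l} (suc m) lt rewrite +-suc k m = ≤-trans (Y-mono-down m (<⇒≤ lt)) (Y-step-down lt)

    -- A smaller pair lies weakly below one of the two predecessors of `(k′ , l′)`, over which `Z`
    -- takes the maximum, and `Y` grows along steps. Moving right before moving down stays above the
    -- diagonal.
    Y≤Z : ∀ {k l k′ l′} → ValidPair n (k , l) → ValidPair n (k′ , l′) → (k , l) ≺ (k′ , l′) → Y k l ≤ Z k′ l′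
    Y≤Z {k} {l} {k′} {l′} (1≤k , k<l , _) (_ , k′<l′ , _) ((k≤k′ , l≤l′) , ≢) with k ≟ k′
    ... | yes refl = ≤-trans
        (subst (λ z → Y k l ≤ Y k z) (m+[n∸m]≡n l≤pl′) (Y-mono-right 1≤k (<⇒≤ k<l) (pred l′ ∸ l)))
        (m≤n⊔m (Y (pred k) l′) _)
      where
      l≤pl′ : l ≤ pred l′
      l≤pl′ = <⇒≤pred (≤∧≢⇒< l≤l′ (≢ ∘ cong (k ,_)))
    ... | no k≢k′ = ≤-trans (subst (λ z → Y k l ≤ Y k z) (m+[n∸m]≡n l≤l′) (Y-mono-right 1≤k (<⇒≤ k<l) (l′ ∸ l)))
        (≤-trans (subst (λ z → Y k l′ ≤ Y z l′) (m+[n∸m]≡n k≤pk′)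
          (Y-mono-down (pred k′ ∸ k) (subst (_< l′) (sym (m+[n∸m]≡n k≤pk′)) (≤-<-trans pred[n]≤n k′<l′))))
        (m≤m⊔n (Y (pred k′) l′) _))
      where
      k≤pk′ : k ≤ pred k′
      k≤pk′ = <⇒≤pred (≤∧≢⇒< k≤k′ k≢k′)

    Λ≤Y : ∀ {k l} → 1 ≤ k → k ≤ l → Λ (pred k) ≤ Y k l
    Λ≤Y {suc k} {l} 1≤k k≤l = subst₂ _≤_ (Y-diag k) (cong (Y (suc k)) (m+[n∸m]≡n k≤l)) (Y-mono-right 1≤k ≤-refl (l ∸ suc k))

    -- The tail is extended backwards through both predecessors over which `Y` maximises. When the
    -- left one is on the diagonal, its value is `Λ k` and the tail has become a whole Dyck path, to
    -- which `N-bound` applies; `Λ k` plus that bound is a prefix sum again.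
    Y+tail≤Λ : ∀ k l ps → Tail n (k , l) ps → Y k l + SN N ps ≤ Λ (lastFst (k , l) ps)
    Y+tail≤Λ zero l ps (tail ((() , _) ∷ _) _ _)
    Y+tail≤Λ (suc k) zero ps (tail ((_ , () , _) ∷ _) _ _)
    Y+tail≤Λ (suc k) (suc l) ps t@(tail vs@((1≤k , s≤s k<l , l≤n) ∷ _) ss (q , last≡ , diag)) =
      subst (_≤ e) (sym eq) (⊔-lub (up k refl) via-left)
      where
      p = (suc k , suc l)
      e = Λ (lastFst p ps)
      s = N (suc k) (suc l) + SN N ps
      eq : Y (suc k) (suc l) + SN N ps ≡ (Y k (suc l) + s) ⊔ (Y (suc k) l + s)
      eq = trans (cong (_+ SN N ps) (trans (Y≡N+Z {suc k} {suc l} (s≤s z≤n) (s≤s k<l)) (+-comm (N (suc k) (suc l)) _)))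
                 (trans (+-assoc (Y k (suc l) ⊔ Y (suc k) l) _ _) (+-distribʳ-⊔ s (Y k (suc l)) (Y (suc k) l)))
      toLast = path-⪯-last p ps ss last≡
      via-left : Y (suc k) l + s ≤ e
      via-left with suc k <? l
      ... | yes k<l′ = Y+tail≤Λ (suc k) l (p ∷ ps)
              (tail ((1≤k , k<l′ , ≤-trans (n≤1+n l) l≤n) ∷ vs) (inj₂ (refl , refl) ∷ ss) (q , last≡ , diag))
      ... | no k≮l′ with ≤-antisym k<l (≮⇒≥ k≮l′)
      ... | refl = subst (λ z → z + s ≤ e) (sym (Y-diag k))
              (≤-trans (+-monoʳ-≤ (Λ k) (N-bound (p ∷ ps) ((p , refl , refl) , (q , last≡ , diag) , vs , ss)))
                       (≤-reflexive (psum-sumFromTo b (≤-trans (n≤1+n k)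
                         (subst (suc k ≤_) (sym (proj₂ toLast)) (proj₁ (All.head (proj₁ toLast))))))))
      -- The index is generalised so that it can be matched. In row zero there is no upper
      -- predecessor; its value `0` is dominated by the left alternative.
      up : ∀ k′ → k ≡ k′ → Y k′ (suc l) + s ≤ e
      up zero _ = ≤-trans (+-monoˡ-≤ s (z≤n {Y (suc k) l})) via-left
      up (suc k′) refl = Y+tail≤Λ (suc k′) (suc l) (p ∷ ps)
        (tail ((s≤s z≤n , ≤-trans k<l (n≤1+n l) , l≤n) ∷ vs) (inj₁ (refl , refl) ∷ ss) (q , last≡ , diag))

    column-tail : ∀ m {k l} → 1 ≤ k → suc (k + m) ≡ l → l ≤ n → ∃ λ ps → Tail n (k , l) ps × lastFst (k , l) ps ≡ pred l
    column-tail zero {k} 1≤k refl l≤n =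
      [] , tail ((1≤k , s≤s (m≤m+n k 0) , l≤n) ∷ []) [-] (_ , refl , cong suc (+-identityʳ k)) , sym (+-identityʳ k)
    column-tail (suc m) {k} 1≤k refl l≤n with column-tail m {suc k} (s≤s z≤n) (cong suc (sym (+-suc k m))) l≤n
    ... | ps , tail vs ss end , eq =
      _ , tail ((1≤k , s≤s (m≤m+n k (suc m)) , l≤n) ∷ vs) (inj₁ (refl , refl) ∷ ss) end , eq

    -- The path is completed by descending column `l` to `(l-1, l)`; the natural numbers collected
    -- on the way are dropped.
    Y≤Λ : ∀ {k l} → ValidPair n (k , l) → Y k l ≤ Λ (pred l)
    Y≤Λ {k} {l} (1≤k , k<l , l≤n) with column-tail (l ∸ suc k) 1≤k (m+[n∸m]≡n k<l) l≤n
    ... | ps , t , eq = ≤-trans (m≤m+n _ (SN N ps)) (subst (λ z → Y k l + SN N ps ≤ Λ z) eq (Y+tail≤Λ k l ps t))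

    InLayer : ℕ → Pair → Set
    InLayer θ (k , l) = Z k l < θ × θ ≤ Y k l

    inLayer? : ∀ θ → Decidable (InLayer θ)
    inLayer? θ (k , l) = Z k l <? θ ×-dec θ ≤? Y k l

    layer : ℕ → List Pair
    layer θ = filter (inLayer? θ) (allPairs n)

    ∈-layer⁻ : ∀ {θ p} → p ∈ layer θ → ValidPair n p × InLayer θ p
    ∈-layer⁻ {θ} p∈ with ∈-filter⁻ (inLayer? θ) {xs = allPairs n} p∈
    ... | p∈all , inl = ∈-allPairs⁻ p∈all , inl

    -- For `p ≺ q` in one layer, `θ ≤ Y p ≤ Z q < θ` would follow.
    layer-antichain : ∀ θ → Antichain (layer θ)
    layer-antichain θ p@(k , l) q@(k′ , l′) p∈ q∈ p⪯q with ≡-dec _≟_ _≟_ p q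
    ... | yes p≡q = p≡q
    ... | no  p≢q with ∈-layer⁻ p∈ | ∈-layer⁻ q∈
    ... | pv , _ , θ≤Y | qv , Z<θ , _ = contradiction (≤-trans θ≤Y (Y≤Z pv qv (p⪯q , p≢q))) (<⇒≱ Z<θ)

    -- From `Λ (k-1) ≤ Z < θ ≤ Λ (i+1)` follows `k-1 < i+1`, and from `Λ i < θ ≤ Y ≤ Λ (l-1)`
    -- follows `i < l-1`. These are the two conditions for `Q` at index `i+1`.
    layer-InQ : ∀ {i θ} → Λ i < θ → θ ≤ Λ (suc i) → All (InQ n (suc i)) (layer θ)
    layer-InQ {i} {θ} Λi<θ θ≤Λ = All.tabulate inQ
      where
      inQ : ∀ {p} → p ∈ layer θ → InQ n (suc i) p
      inQ {suc k , l} p∈ with ∈-layer⁻ p∈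
      ... | v@(1≤k , k<l , l≤n) , Z<θ , θ≤Y = 1≤k ,
        psum-cancel-< b (≤-<-trans (≤-trans (Λ≤Y 1≤k (<⇒≤pred k<l)) (m≤n⊔m (Y k l) _)) (<-≤-trans Z<θ θ≤Λ)) ,
        <-≤-trans (s≤s (psum-cancel-< b (<-≤-trans Λi<θ (≤-trans θ≤Y (Y≤Λ v)))))
          (≤-reflexive (suc-pred l {{>-nonZero (≤-trans (s≤s z≤n) k<l)}})) ,
        l≤n
      inQ {zero , l} p∈ with ∈-layer⁻ p∈
      ... | (() , _) , _

    block : ℕ → ℕ → ℕ → List (ℕ × List Pair)
    block i base zero = []
    block i base (suc m) = (i , layer (suc (base + m))) ∷ block i base m

    -- The `b (i+1)` thresholds above `Λ i` and up to `Λ (i+1)` carry the index `i+1`; together the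
    -- blocks run through `1, …, Λ m`.
    layers : ℕ → List (ℕ × List Pair)
    layers zero = []
    layers (suc i) = block (suc i) (Λ i) (b (suc i)) ++ layers i

    -- The number `(y ⊓ w) ∸ z` counts the thresholds `θ ≤ w` with `z < θ ≤ y`; the two cases say
    -- whether `w + 1` is another one.
    layer-step : ∀ y z w → (z < suc w → suc w ≤ y → suc ((y ⊓ w) ∸ z) ≡ (y ⊓ suc w) ∸ z) ×
                           (¬ (z < suc w × suc w ≤ y) → (y ⊓ w) ∸ z ≡ (y ⊓ suc w) ∸ z)
    layer-step y z w = inside , outside
      where
      inside : z < suc w → suc w ≤ y → suc ((y ⊓ w) ∸ z) ≡ (y ⊓ suc w) ∸ z
      inside (s≤s z≤w) w<y rewrite m≥n⇒m⊓n≡n (<⇒≤ w<y) | m≥n⇒m⊓n≡n w<y = sym (+-∸-assoc 1 z≤w)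
      outside : ¬ (z < suc w × suc w ≤ y) → (y ⊓ w) ∸ z ≡ (y ⊓ suc w) ∸ z
      outside ¬both with suc w ≤? y
      ... | no w≮y rewrite m≤n⇒m⊓n≡m (≮⇒≥ w≮y) | m≤n⇒m⊓n≡m (m≤n⇒m≤1+n (≮⇒≥ w≮y)) = refl
      ... | yes w<y rewrite m≥n⇒m⊓n≡n (<⇒≤ w<y) | m≥n⇒m⊓n≡n w<y
        with z <? suc w
      ... | yes z≤w = contradiction (z≤w , w<y) ¬both
      ... | no z≰w = trans (m≤n⇒m∸n≡0 (≤-trans (n≤1+n w) (≮⇒≥ z≰w))) (sym (m≤n⇒m∸n≡0 (≮⇒≥ z≰w)))

    χ-layer : ∀ {k l} → ValidPair n (k , l) → ∀ w →
      χ (layer (suc w)) k l + ((Y k l ⊓ w) ∸ Z k l) ≡ (Y k l ⊓ suc w) ∸ Z k l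
    χ-layer {k} {l} v w with inLayer? (suc w) (k , l)
    ... | yes inl@(Z<θ , θ≤Y) = trans (cong (_+ ((Y k l ⊓ w) ∸ Z k l)) (χ-∈ (∈-filter⁺ (inLayer? (suc w)) (∈-allPairs⁺ v) inl)))
            (proj₁ (layer-step (Y k l) (Z k l) w) Z<θ θ≤Y)
    ... | no ¬inl = trans (cong (_+ ((Y k l ⊓ w) ∸ Z k l)) (χ-∉ {layer (suc w)} (¬inl ∘ proj₂ ∘ ∈-layer⁻)))
            (proj₂ (layer-step (Y k l) (Z k l) w) ¬inl)

    total-block : ∀ {k l} → ValidPair n (k , l) → ∀ i base m →
      total (λ _ B → χ B k l) (block i base m) + ((Y k l ⊓ base) ∸ Z k l) ≡ (Y k l ⊓ (base + m)) ∸ Z k l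
    total-block {k} {l} v i base zero = cong (λ z → (Y k l ⊓ z) ∸ Z k l) (sym (+-identityʳ base))
    total-block {k} {l} v i base (suc m) = trans (+-assoc (χ (layer (suc (base + m))) k l) _ _)
      (trans (cong (χ (layer (suc (base + m))) k l +_) (total-block v i base m))
      (trans (χ-layer v (base + m)) (cong (λ z → (Y k l ⊓ z) ∸ Z k l) (sym (+-suc base m)))))

    total-layers : ∀ {k l} → ValidPair n (k , l) → ∀ m → total (λ _ B → χ B k l) (layers m) ≡ (Y k l ⊓ Λ m) ∸ Z k l
    total-layers {k} {l} v zero = sym (trans (cong (_∸ Z k l) (⊓-zeroʳ (Y k l))) (0∸n≡0 (Z k l)))
    total-layers {k} {l} v (suc m) = trans (total-++ _ (block (suc m) (Λ m) (b (suc m))) (layers m))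
      (trans (cong (total _ (block (suc m) (Λ m) (b (suc m))) +_) (total-layers v m)) (total-block v (suc m) (Λ m) (b (suc m))))

    -- As `Y ≤ Λ (n-1)`, no threshold is cut off, and the count is `Y - Z = N`.
    layers-sum : ∀ {k l} → ValidPair n (k , l) → total (λ _ B → χ B k l) (layers (n ∸ 1)) ≡ N k l
    layers-sum {k} {l} v@(1≤k , k<l , l≤n) = trans (total-layers v (n ∸ 1))
      (trans (cong (_∸ Z k l) (m≤n⇒m⊓n≡m (≤-trans (Y≤Λ v) (psum-mono b (∸-monoˡ-≤ 1 l≤n)))))
      (trans (cong (_∸ Z k l) (Y≡N+Z 1≤k k<l)) (m+n∸n≡m (N k l) (Z k l))))

    total-block-level : ∀ (f : ℕ → ℕ) i base m → total (λ i _ → f i) (block i base m) ≡ m * f i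
    total-block-level f i base zero = refl
    total-block-level f i base (suc m) = cong (f i +_) (total-block-level f i base m)

    total-level : ∀ (f : ℕ → ℕ) m → total (λ i _ → f i) (layers m) ≡ psum (λ i → b i * f i) m
    total-level f zero = refl
    total-level f (suc m) = trans (total-++ _ (block (suc m) (Λ m) (b (suc m))) (layers m))
      (trans (cong₂ _+_ (total-block-level f (suc m) (Λ m) (b (suc m))) (total-level f m)) (+-comm (b (suc m) * f (suc m)) _))

    layers-antichains : ∀ m → All (λ (i , B) → B ∈ antichains n i) (layers m)
    layers-antichains zero = []
    layers-antichains (suc i) = All.++⁺ (go (b (suc i)) ≤-refl) (layers-antichains i)
      where
      go : ∀ m → m ≤ b (suc i) → All (λ (i , B) → B ∈ antichains n i) (block (suc i) (Λ i) m)
      go zero _ = []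
      go (suc m) m<b = ∈-filter⁺ (antichainIn? n (suc i)) (filter-∈-sublists (inLayer? (suc (Λ i + m))) (allPairs n))
          (layer-InQ (s≤s (m≤m+n (Λ i) m)) (subst (_≤ Λ (suc i)) (+-suc (Λ i) m) (+-monoʳ-≤ (Λ i) m<b)) ,
           layer-antichain (suc (Λ i + m)))
        ∷ go m (<⇒≤ m<b)

module Vertices where
  open ExposedPoints
  open Combinatorics
  open import Algebra.Bundles using (CommutativeMonoid)
  open import Data.Nat using (ℕ; zero; suc; _∸_; z≤n; s≤s)
  import Data.Nat as ℕ
  import Data.Nat.Properties as ℕₚ
  open import Data.Rational using (ℚ; 0ℚ; 1ℚ; _+_; _*_; _-_; -_; _≤_; _<_; positive)
  open import Data.Rational.Properties
  open import Algebra.Properties.Group +-0-group using (⁻¹-involutive; ∙-cancelʳ)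
  open import Data.Rational.Solver using (module +-*-Solver)
  open import Data.List using (List; []; _∷_; _++_; head; last; length; map; filter; foldr; upTo; cartesianProductWith)
  open import Relation.Binary using (DecTotalOrder)
  open import Data.List.Extrema (DecTotalOrder.totalOrder ≤-decTotalOrder) using (argmax; argmax-sel; f[xs]≤f[argmax])
  open import Data.List.Relation.Unary.All as All using (All; []; _∷_)
  import Data.List.Relation.Unary.All.Properties as All
  open import Data.List.Relation.Unary.Any using (here; there)
  open import Data.List.Relation.Unary.Linked as Linked using (Linked; []; [-]; _∷_)
  open import Data.List.Membership.Propositional using (_∈_)
  open import Data.List.Membership.Propositional.Properties using (∈-filter⁺; ∈-filter⁻; ∈-map⁺; ∈-++⁺ʳ; ∈-cartesianProductWith⁺)
  open import Data.Maybe using (just; nothing)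
  open import Data.Product using (∃; _×_; _,_; proj₁; proj₂)
  open import Data.Sum using (inj₁; inj₂; [_,_]′)
  open import Function using (id)
  open import Data.Unit using (⊤; tt)
  open import Relation.Nullary using (Dec; yes; no; contradiction; _×-dec_; _⊎-dec_)
  open import Relation.Unary using (Decidable)
  open import Relation.Binary.PropositionalEquality using (_≡_; refl; sym; trans; cong; cong₂; subst; subst₂)
  open Functional

  private
    variable
      n : ℕ

  -- Coordinates and path sums as functionals; additivity in the weight.

  atPair : (p : Pair) → Dec (ValidPair n p) → Functional n
  atPair (i , j) (yes v) .eval x = x i j
  atPair (i , j) (yes v) .resp x≈y = x≈y i j v
  atPair (i , j) (yes v) .lin s x t y = refl
  atPair p (no _) = zeroF

  -- Zero at pairs that are not coordinates of U, so that it respects ≈[ n ].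
  coordF : ∀ n → Pair → Functional n
  coordF n p = atPair p (valid? n p)

  atPair-eval : ∀ {i j} (v? : Dec (ValidPair n (i , j))) → ValidPair n (i , j) → ∀ x → eval (atPair (i , j) v?) x ≡ x i j
  atPair-eval (yes _) v x = refl
  atPair-eval (no ¬v) v x = contradiction v ¬v

  coordF-eval : ∀ {i j} → ValidPair n (i , j) → ∀ x → eval (coordF n (i , j)) x ≡ x i j
  coordF-eval {n} {i} {j} v x = atPair-eval (valid? n (i , j)) v x

  pathF : ∀ n → List Pair → Functional n
  pathF n [] = zeroF
  pathF n (p ∷ d) = coordF n p +F pathF n d

  pathF-eval : ∀ {d} → All (ValidPair n) d → ∀ x → eval (pathF n d) x ≡ S x d
  pathF-eval [] x = refl
  pathF-eval (v ∷ vs) x = cong₂ _+_ (coordF-eval v x) (pathF-eval vs x)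

  S-resp : ∀ {d x y} → All (ValidPair n) d → x ≈[ n ] y → S x d ≡ S y d
  S-resp {n} {d} {x} {y} vs x≈y = trans (sym (pathF-eval vs x)) (trans (resp (pathF n d) x≈y) (pathF-eval vs y))

  S-+ : ∀ x y d → S (λ i j → x i j + y i j) d ≡ S x d + S y d
  S-+ x y [] = sym (+-identityʳ 0ℚ)
  S-+ x y ((i , j) ∷ d) = trans (cong (x i j + y i j +_) (S-+ x y d)) (interchange (x i j) (y i j) (S x d) (S y d))
    where
    open CommutativeMonoid +-0-commutativeMonoid using (commutativeSemigroup)
    open import Algebra.Properties.CommutativeSemigroup commutativeSemigroup using (interchange)

  S-ℕ : ∀ N d → S (λ k l → ℕ→ℚ (N k l)) d ≡ ℕ→ℚ (SN N d)
  S-ℕ N [] = refl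
  S-ℕ N ((k , l) ∷ d) = trans (cong (ℕ→ℚ (N k l) +_) (S-ℕ N d)) (sym (ℕ→ℚ-+ (N k l) (SN N d)))

  S-scaled : ∀ c x N d → All (λ (k , l) → c * x k l ≡ ℕ→ℚ (N k l)) d → c * S x d ≡ ℕ→ℚ (SN N d)
  S-scaled c x N [] [] = *-zeroʳ c
  S-scaled c x N ((k , l) ∷ d) (eq ∷ eqs) =
    trans (*-distribˡ-+ c (x k l) (S x d)) (trans (cong₂ _+_ eq (S-scaled c x N d eqs)) (sym (ℕ→ℚ-+ (N k l) (SN N d))))

  sum-map-* : ∀ c (g : ℕ → ℕ) ts → foldr ℕ._+_ 0 (map (λ t → c ℕ.* g t) ts) ≡ c ℕ.* foldr ℕ._+_ 0 (map g ts)
  sum-map-* c g [] = sym (ℕₚ.*-zeroʳ c)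
  sum-map-* c g (t ∷ ts) = trans (cong (c ℕ.* g t ℕ.+_) (sum-map-* c g ts)) (sym (ℕₚ.*-distribˡ-+ c (g t) _))

  sum-map-+ : ∀ (g h : ℕ → ℕ) ts → foldr ℕ._+_ 0 (map (λ t → g t ℕ.+ h t) ts) ≡
    foldr ℕ._+_ 0 (map g ts) ℕ.+ foldr ℕ._+_ 0 (map h ts)
  sum-map-+ g h [] = refl
  sum-map-+ g h (t ∷ ts) = trans (cong (g t ℕ.+ h t ℕ.+_) (sum-map-+ g h ts))
    (interchange (g t) (h t) (foldr ℕ._+_ 0 (map g ts)) (foldr ℕ._+_ 0 (map h ts)))
    where open import Algebra.Properties.CommutativeSemigroup ℕₚ.+-commutativeSemigroup using (interchange)

  M-* : ∀ c b d → M (λ i → c ℕ.* b i) d ≡ c ℕ.* M b d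
  M-* c b [] = sym (ℕₚ.*-zeroʳ c)
  M-* c b (p ∷ ps) = sum-map-* c (λ t → b (proj₁ p ℕ.+ t)) (upTo (suc (lastFst p ps) ∸ proj₁ p))

  M-+ : ∀ b c d → M (λ i → b i ℕ.+ c i) d ≡ M b d ℕ.+ M c d
  M-+ b c [] = refl
  M-+ b c (p ∷ ps) = sum-map-+ (λ t → b (proj₁ p ℕ.+ t)) (λ t → c (proj₁ p ℕ.+ t)) (upTo (suc (lastFst p ps) ∸ proj₁ p))

  InP-resp : ∀ {b x y} → x ≈[ n ] y → InP n b x → InP n b y
  InP-resp x≈y (nonneg , paths) =
    (λ i j v → subst (0ℚ ≤_) (x≈y i j v) (nonneg i j v)) ,
    (λ d dyck@(_ , _ , vs , _) → subst (_≤ _) (S-resp vs x≈y) (paths d dyck))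

  InP-+ : ∀ {b c x y} → InP n b x → InP n c y → InP n (λ i → b i ℕ.+ c i) (λ i j → x i j + y i j)
  InP-+ {b = b} {c} {x} {y} (x≥0 , x-paths) (y≥0 , y-paths) =
    (λ i j v → +-mono-≤ (x≥0 i j v) (y≥0 i j v)) ,
    (λ d dyck → subst₂ _≤_ (sym (S-+ x y d)) (sym (trans (cong ℕ→ℚ (M-+ b c d)) (ℕ→ℚ-+ (M b d) (M c d))))
      (+-mono-≤ (x-paths d dyck) (y-paths d dyck)))

  combo-InP : ∀ a A → AntichainTuple n A → InP n a (combo n a A)
  combo-InP {n} a A tuple =
    (λ k l _ → ℕ→ℚ-nonNeg (sumFromTo (λ i → a i ℕ.* χ (A i) k l) 1 (n ∸ 1))) ,
    (λ d dyck → subst (_≤ ℕ→ℚ (M a d)) (sym (S-ℕ _ d)) (ℕ→ℚ-mono-≤ (dyck-combo-≤ n a A tuple d dyck)))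

  combo-+ : ∀ n a b A k l → combo n (λ i → a i ℕ.+ b i) A k l ≡ combo n a A k l + combo n b A k l
  combo-+ n a b A k l = trans (cong ℕ→ℚ eq) (ℕ→ℚ-+ (sumFromTo (f a) 1 (n ∸ 1)) (sumFromTo (f b) 1 (n ∸ 1)))
    where
    f : (ℕ → ℕ) → ℕ → ℕ
    f a i = a i ℕ.* χ (A i) k l
    eq : sumFromTo (f (λ i → a i ℕ.+ b i)) 1 (n ∸ 1) ≡ sumFromTo (f a) 1 (n ∸ 1) ℕ.+ sumFromTo (f b) 1 (n ∸ 1)
    eq = trans (sumFromTo-psum _ (n ∸ 1)) (trans (psum-cong (n ∸ 1) (λ i → ℕₚ.*-distribʳ-+ (χ (A i) k l) (a i) (b i)))
      (trans (psum-+ (f a) (f b) (n ∸ 1)) (sym (cong₂ ℕ._+_ (sumFromTo-psum (f a) (n ∸ 1)) (sumFromTo-psum (f b) (n ∸ 1))))))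

  -- The polytope as a finite system of inequalities.

  step? : ∀ p q → Dec (Step p q)
  step? (i , j) (i′ , j′) = (i′ ℕ.≟ suc i ×-dec j′ ℕ.≟ j) ⊎-dec (i′ ℕ.≟ i ×-dec j′ ℕ.≟ suc j)

  justDiag? : ∀ m → Dec (∃ λ p → m ≡ just p × Diag p)
  justDiag? nothing = no λ { (_ , () , _) }
  justDiag? (just (i , j)) with j ℕ.≟ suc i
  ... | yes diag = yes (_ , refl , diag)
  ... | no ¬diag = no λ { (_ , refl , diag) → ¬diag diag }

  isDyck? : ∀ n → Decidable (IsDyck n)
  isDyck? n d = justDiag? (head d) ×-dec justDiag? (last d) ×-dec All.all? (valid? n) d ×-dec Linked.linked? step? d

  words : ∀ {X : Set} → List X → ℕ → List (List X)
  words xs zero = [] ∷ []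
  words xs (suc m) = [] ∷ cartesianProductWith _∷_ xs (words xs m)

  ∈-words : ∀ {X : Set} {xs : List X} {w m} → All (_∈ xs) w → length w ℕ.≤ m → w ∈ words xs m
  ∈-words {w = []} {zero} _ _ = here refl
  ∈-words {w = []} {suc m} _ _ = here refl
  ∈-words {w = x ∷ w} {suc m} (x∈ ∷ w∈) (s≤s le) = there (∈-cartesianProductWith⁺ _∷_ x∈ (∈-words w∈ le))

  -- Each step raises `i + j` by one, and `i + j` never exceeds `2n`.
  path-length : ∀ {i j ps} → All (ValidPair n) ((i , j) ∷ ps) → Linked Step ((i , j) ∷ ps) → length ps ℕ.+ (i ℕ.+ j) ℕ.≤ n ℕ.+ n
  path-length ((_ , i<j , j≤n) ∷ _) [-] = ℕₚ.+-mono-≤ (ℕₚ.≤-trans (ℕₚ.<⇒≤ i<j) j≤n) j≤n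
  path-length {n} {i} {j} {_ ∷ ps} (_ ∷ vs) (inj₁ (refl , refl) ∷ ss) =
    subst (ℕ._≤ n ℕ.+ n) (ℕₚ.+-suc (length ps) (i ℕ.+ j)) (path-length vs ss)
  path-length {n} {i} {j} {_ ∷ ps} (_ ∷ vs) (inj₂ (refl , refl) ∷ ss) =
    subst (ℕ._≤ n ℕ.+ n) (trans (cong (length ps ℕ.+_) (ℕₚ.+-suc i j)) (ℕₚ.+-suc (length ps) (i ℕ.+ j))) (path-length vs ss)

  dyckPaths : ℕ → List (List Pair)
  dyckPaths n = filter (isDyck? n) (words (allPairs n) (n ℕ.+ n))

  ∈-dyckPaths : ∀ {d} → IsDyck n d → d ∈ dyckPaths n
  ∈-dyckPaths {n} {d} dyck@(_ , _ , vs , ss) = ∈-filter⁺ (isDyck? n) (∈-words (All.map ∈-allPairs⁺ vs) (bound d vs ss)) dyck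
    where
    bound : ∀ d → All (ValidPair n) d → Linked Step d → length d ℕ.≤ n ℕ.+ n
    bound [] _ _ = z≤n
    -- The first coordinate is at least one, which pays for counting the starting point.
    bound ((suc i , j) ∷ ps) vs ss = ℕₚ.≤-trans
      (subst (suc (length ps) ℕ.≤_) (sym (ℕₚ.+-suc (length ps) (i ℕ.+ j))) (s≤s (ℕₚ.m≤m+n _ _))) (path-length vs ss)
    bound ((zero , j) ∷ ps) ((() , _) ∷ _) ss

  constraints : ∀ n → (ℕ → ℕ) → List (Constraint n)
  constraints n b = map (λ p → -F coordF n p , 0ℚ) (allPairs n) ++ map (λ d → pathF n d , ℕ→ℚ (M b d)) (dyckPaths n)

  InP⇒Sat : ∀ {b x} → InP n b x → Sat (constraints n b) x
  InP⇒Sat {n} {b} {x} (nonneg , paths) = All.++⁺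
    (All.map⁺ (All.tabulate λ {(i , j)} p∈ → let v = ∈-allPairs⁻ p∈ in
      subst (λ z → - z ≤ 0ℚ) (sym (coordF-eval v x)) (neg-antimono-≤ (nonneg i j v))))
    (All.map⁺ (All.tabulate λ {d} d∈ → let dyck = proj₂ (∈-filter⁻ (isDyck? n) {xs = words (allPairs n) (n ℕ.+ n)} d∈) in
      subst (_≤ ℕ→ℚ (M b d)) (sym (pathF-eval (proj₁ (proj₂ (proj₂ dyck))) x)) (paths d dyck)))

  Sat⇒InP : ∀ {b x} → Sat (constraints n b) x → InP n b x
  Sat⇒InP {n} {b} {x} sat =
    (λ i j v → subst (0ℚ ≤_) (trans (⁻¹-involutive _) (coordF-eval v x))
      (neg-antimono-≤ (All.lookup (All.map⁻ (All.++⁻ˡ _ sat)) (∈-allPairs⁺ v)))) ,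
    (λ d dyck → subst (_≤ ℕ→ℚ (M b d)) (pathF-eval (proj₁ (proj₂ (proj₂ dyck))) x)
      (All.lookup (All.map⁻ (All.++⁻ʳ (map (λ p → -F coordF n p , 0ℚ) (allPairs n)) sat)) (∈-dyckPaths dyck)))

  vertex⇒exposed : ∀ {b v} → IsVertex n b v → ∃ λ F → ∀ x → InP n b x → eval F v ≤ eval F x → v ≈[ n ] x
  vertex⇒exposed {n} {b} (v∈P , ext) =
    let F , exposed = extreme⇒exposed (constraints n b) (InP⇒Sat v∈P)
                        (λ p q t p∈ q∈ → ext p q t (Sat⇒InP p∈) (Sat⇒InP q∈))
    in F , λ x x∈ → exposed x (InP⇒Sat x∈)

  -- Decomposition of rational points.

  common-denominator : ∀ (x : Point) (ps : List Pair) → All (λ (k , l) → 0ℚ ≤ x k l) ps →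
    ∃ λ D → All (λ (k , l) → ∃ λ m → ℕ→ℚ (suc D) * x k l ≡ ℕ→ℚ m) ps
  common-denominator x [] [] = 0 , []
  common-denominator x ((k , l) ∷ ps) (nn ∷ nns) =
    let D , ms = common-denominator x ps nns
        d , m , eq = clear-denominator (x k l) nn
    -- The successor of this number computes to `suc D * suc d`.
    in d ℕ.+ D ℕ.* suc d ,
       (suc D ℕ.* m , trans (cong (_* x k l) (ℕ→ℚ-* (suc D) (suc d)))
         (trans (*-assoc (ℕ→ℚ (suc D)) (ℕ→ℚ (suc d)) (x k l)) (trans (cong (ℕ→ℚ (suc D) *_) eq) (sym (ℕ→ℚ-* (suc D) m))))) ∷
       All.map (λ {(k′ , l′)} (m′ , eq′) → suc d ℕ.* m′ ,
         trans (cong (λ z → ℕ→ℚ z * x k′ l′) (ℕₚ.*-comm (suc D) (suc d)))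
         (trans (cong (_* x k′ l′) (ℕ→ℚ-* (suc d) (suc D)))
         (trans (*-assoc (ℕ→ℚ (suc d)) (ℕ→ℚ (suc D)) (x k′ l′)) (trans (cong (ℕ→ℚ (suc d) *_) eq′) (sym (ℕ→ℚ-* (suc d) m′)))))) ms

  -- The field `levels` expresses that `suc scale * a i` pieces have index `i`, in the form in which
  -- it is used: exchanging every piece of index `i` for `A i` turns the scaled `x` into the scaled
  -- `combo n a A`.
  record Decomposition (n : ℕ) (a : ℕ → ℕ) (x : Point) : Set where
    field
      scale   : ℕ
      pieces  : List (ℕ × List Pair)
      members : All (λ (i , B) → B ∈ antichains n i) pieces
      point   : ∀ k l → ValidPair n (k , l) → ℕ→ℚ (suc scale) * x k l ≡ ℕ→ℚ (total (λ _ B → χ B k l) pieces)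
      levels  : ∀ A k l → ℕ→ℚ (suc scale) * combo n a A k l ≡ ℕ→ℚ (total (λ i _ → χ (A i) k l) pieces)

  open Decomposition

  decompose : ∀ {a x} → InP n a x → Decomposition n a x
  decompose {n} {a} {x} (nonneg , paths) = record
    { scale = D ; pieces = layers (n ∸ 1) ; members = layers-antichains (n ∸ 1)
    ; point = λ k l v → trans (N-spec k l v) (cong ℕ→ℚ (sym (layers-sum v)))
    ; levels = λ A k l → trans (sym (ℕ→ℚ-* (suc D) (sumFromTo (λ i → a i ℕ.* χ (A i) k l) 1 (n ∸ 1))))
        (cong ℕ→ℚ (level-eq A k l))
    }
    where
    common = common-denominator x (allPairs n) (All.tabulate λ {(k , l)} p∈ → nonneg k l (∈-allPairs⁻ p∈))
    D = proj₁ common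
    numerator : ∀ k l → Dec (ValidPair n (k , l)) → ∃ λ m → ValidPair n (k , l) → ℕ→ℚ (suc D) * x k l ≡ ℕ→ℚ m
    numerator k l (yes v) = proj₁ cleared , λ _ → proj₂ cleared
      where
      cleared : ∃ λ m → ℕ→ℚ (suc D) * x k l ≡ ℕ→ℚ m
      cleared = All.lookup (proj₂ common) (∈-allPairs⁺ v)
    numerator k l (no ¬v) = 0 , λ v → contradiction v ¬v
    N : ℕ → ℕ → ℕ
    N k l = proj₁ (numerator k l (valid? n (k , l)))
    N-spec : ∀ k l → ValidPair n (k , l) → ℕ→ℚ (suc D) * x k l ≡ ℕ→ℚ (N k l)
    N-spec k l = proj₂ (numerator k l (valid? n (k , l)))
    -- Scaling `x` by `suc D` scales the path bounds alike, so the integral point `N` obeys those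
    -- for `b`.
    b : ℕ → ℕ
    b i = suc D ℕ.* a i
    N-bound : ∀ d → IsDyck n d → SN N d ℕ.≤ M b d
    N-bound d dyck@(_ , _ , vs , _) = ℕ→ℚ-cancel-≤ (subst₂ _≤_
      (S-scaled (ℕ→ℚ (suc D)) x N d (All.map (λ {(k , l)} → N-spec k l) vs))
      (trans (sym (ℕ→ℚ-* (suc D) (M a d))) (cong ℕ→ℚ (sym (M-* (suc D) a d))))
      (*-mono-≤ˡ (ℕ→ℚ-nonNeg (suc D)) (paths d dyck)))
    open Layers n N b N-bound
    level-eq : ∀ A k l → suc D ℕ.* sumFromTo (λ i → a i ℕ.* χ (A i) k l) 1 (n ∸ 1) ≡ total (λ i _ → χ (A i) k l) (layers (n ∸ 1))
    level-eq A k l = trans (cong (suc D ℕ.*_) (sumFromTo-psum (λ i → a i ℕ.* χ (A i) k l) (n ∸ 1)))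
      (trans (sym (psum-* (suc D) (λ i → a i ℕ.* χ (A i) k l) (n ∸ 1)))
      (trans (psum-cong (n ∸ 1) (λ i → sym (ℕₚ.*-assoc (suc D) (a i) (χ (A i) k l))))
      (sym (total-level (λ i → χ (A i) k l) (n ∸ 1)))))

  -- Comparing functionals piece by piece.

  value : Functional n → List Pair → ℚ
  value F B = eval F (λ k l → ℕ→ℚ (χ B k l))

  totalℚ : (ℕ → List Pair → ℚ) → List (ℕ × List Pair) → ℚ
  totalℚ f = foldr (λ (i , B) s → f i B + s) 0ℚ

  eval-scale : ∀ (F : Functional n) s x → eval F (λ k l → s * x k l) ≡ s * eval F x
  eval-scale {n} F s x = trans (resp F {y = lincomb s x 0ℚ x} (λ k l _ → sym (drop (s * x k l) (x k l))))
    (trans (lin F s x 0ℚ x) (drop (s * eval F x) (eval F x)))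
    where
    drop : ∀ p q → p + 0ℚ * q ≡ p
    drop p q = trans (cong (p +_) (*-zeroˡ q)) (+-identityʳ p)

  eval-total : ∀ (F : Functional n) (g : ℕ → List Pair → List Pair) xs →
    eval F (λ k l → ℕ→ℚ (total (λ i B → χ (g i B) k l) xs)) ≡ totalℚ (λ i B → value F (g i B)) xs
  -- The zero point is written as a multiple by `0ℚ`, so that homogeneity gives the value.
  eval-total F g [] = trans (resp F {y = λ k l → 0ℚ * 0ℚ} (λ _ _ _ → refl))
    (trans (eval-scale F 0ℚ (λ _ _ → 0ℚ)) (*-zeroˡ (eval F (λ _ _ → 0ℚ))))
  eval-total {n} F g ((i , B) ∷ xs) = trans (resp F {y = lincomb 1ℚ y 1ℚ z} (λ k l _ → split k l))
    (trans (lin F 1ℚ y 1ℚ z) (cong₂ _+_ (*-identityˡ (eval F y)) (trans (*-identityˡ (eval F z)) (eval-total F g xs))))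
    where
    y z : Point
    y k l = ℕ→ℚ (χ (g i B) k l)
    z k l = ℕ→ℚ (total (λ i B → χ (g i B) k l) xs)
    split : ∀ k l → ℕ→ℚ (χ (g i B) k l ℕ.+ total (λ i B → χ (g i B) k l) xs) ≡ lincomb 1ℚ y 1ℚ z k l
    split k l = trans (ℕ→ℚ-+ (χ (g i B) k l) (total (λ i B → χ (g i B) k l) xs))
      (sym (cong₂ _+_ (*-identityˡ (y k l)) (*-identityˡ (z k l))))

  totalℚ-mono : ∀ {f g} xs → All (λ (i , B) → f i B ≤ g i B) xs → totalℚ f xs ≤ totalℚ g xs
  totalℚ-mono [] [] = ≤-refl
  totalℚ-mono (_ ∷ xs) (le ∷ les) = +-mono-≤ le (totalℚ-mono xs les)

  totalℚ-tight : ∀ {f g} xs → All (λ (i , B) → f i B ≤ g i B) xs → totalℚ g xs ≤ totalℚ f xs →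
    All (λ (i , B) → f i B ≡ g i B) xs
  totalℚ-tight [] [] _ = []
  totalℚ-tight (_ ∷ xs) (le ∷ les) ge =
    +-squeezeˡ le (totalℚ-mono xs les) ge ∷
    totalℚ-tight xs les (≤-reflexive (sym (+-squeezeʳ le (totalℚ-mono xs les) ge)))

  module _ {a x} (dec : Decomposition n a x) (F : Functional n) (A : ℕ → List Pair) where
    private
      c = ℕ→ℚ (suc (scale dec))

    eval-point : c * eval F x ≡ totalℚ (λ _ B → value F B) (pieces dec)
    eval-point = trans (sym (eval-scale F c x)) (trans (resp F (point dec)) (eval-total F (λ _ B → B) (pieces dec)))

    eval-combo : c * eval F (combo n a A) ≡ totalℚ (λ i _ → value F (A i)) (pieces dec)
    eval-combo = trans (sym (eval-scale F c (combo n a A)))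
      (trans (resp F (λ k l _ → levels dec A k l)) (eval-total F (λ i _ → A i) (pieces dec)))

    -- Exchanging the pieces for the `A i` one by one never lowers `F`. If in the end nothing is
    -- gained, then no single exchange gained anything, which is the next lemma.
    decomposition-≤ : All (λ (i , B) → value F B ≤ value F (A i)) (pieces dec) → eval F x ≤ eval F (combo n a A)
    decomposition-≤ les = *-cancelˡ-≤-pos c {{positive (ℕ→ℚ-pos (scale dec))}}
      (subst₂ _≤_ (sym eval-point) (sym eval-combo) (totalℚ-mono (pieces dec) les))

    decomposition-tight : All (λ (i , B) → value F B ≤ value F (A i)) (pieces dec) → eval F x ≡ eval F (combo n a A) →
      All (λ (i , B) → value F B ≡ value F (A i)) (pieces dec)
    decomposition-tight les eq = totalℚ-tight (pieces dec) les
      (≤-reflexive (trans (sym eval-combo) (trans (cong (c *_) (sym eq)) eval-point)))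

  -- Lexicographic maxima.

  LexMax : List (Functional n) → (List Pair → Set) → List Pair → Set
  LexMax [] P A = ⊤
  LexMax (F ∷ Fs) P A = (∀ B → P B → value F B ≤ value F A) × LexMax Fs (λ B → P B × value F B ≡ value F A) A

  LexMax-⊆ : ∀ (Fs : List (Functional n)) {P Q A} → (∀ {B} → Q B → P B) → LexMax Fs P A → LexMax Fs Q A
  LexMax-⊆ [] Q⊆P _ = tt
  LexMax-⊆ (F ∷ Fs) Q⊆P (max , lex) = (λ B q → max B (Q⊆P q)) , LexMax-⊆ Fs (λ (q , eq) → Q⊆P q , eq) lex

  lexMax : ∀ (Fs : List (Functional n)) Bs {B} → B ∈ Bs → ∃ λ A → A ∈ Bs × LexMax Fs (_∈ Bs) A
  lexMax [] Bs {B} B∈ = B , B∈ , tt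
  lexMax (F ∷ Fs) Bs {B} B∈ =
    let A , A∈ , lex = lexMax Fs (filter top? Bs) (∈-filter⁺ top? m∈ refl)
        A∈Bs , A-top = ∈-filter⁻ top? {xs = Bs} A∈
    in A , A∈Bs ,
       (λ C C∈ → subst (value F C ≤_) (sym A-top) (All.lookup (f[xs]≤f[argmax] {f = value F} B Bs) C∈)) ,
       LexMax-⊆ Fs (λ (C∈ , eq) → ∈-filter⁺ top? C∈ (trans eq A-top)) lex
    where
    m = argmax (value F) B Bs
    top? : ∀ C → Dec (value F C ≡ value F m)
    top? C = value F C ≟ value F m
    m∈ : m ∈ Bs
    -- `argmax` may return its default value `B`, which is itself taken from `Bs`.
    m∈ = [ (λ eq → subst (_∈ Bs) (sym eq) B∈) , id ]′ (argmax-sel (value F) B Bs)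

  -- Neither `p` nor `q` exceeds the combination in `F`, and it is their average, so both attain its
  -- value. Then all their pieces tie with the `A i`, so they remain candidates when the next
  -- functional is compared; `P` records the ties so far.
  lexMax-rigid : ∀ (Fs : List (Functional n)) {a A p q t} {P : ℕ → List Pair → Set} → (∀ i → LexMax Fs (P i) (A i)) →
    (dp : Decomposition n a p) (dq : Decomposition n a q) →
    All (λ (i , B) → P i B) (pieces dp) → All (λ (i , B) → P i B) (pieces dq) →
    0ℚ < t → t < 1ℚ → combo n a A ≈[ n ] convex t p q →
    All (λ F → eval F p ≡ eval F q) Fs
  lexMax-rigid [] _ _ _ _ _ _ _ _ = []
  lexMax-rigid {n} (F ∷ Fs) {a} {A} {p} {q} {t} {P} lex dp dq Pp Pq 0<t t<1 split =
    trans (proj₁ maximal) (sym (proj₂ maximal)) ∷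
    lexMax-rigid Fs {P = λ i B → P i B × value F B ≡ value F (A i)} (λ i → proj₂ (lex i)) dp dq
      (All.zip (Pp , decomposition-tight dp F A (below Pp) (proj₁ maximal)))
      (All.zip (Pq , decomposition-tight dq F A (below Pq) (proj₂ maximal)))
      0<t t<1 split
    where
    below : ∀ {xs} → All (λ (i , B) → P i B) xs → All (λ (i , B) → value F B ≤ value F (A i)) xs
    below = All.map (λ {(i , B)} PB → proj₁ (lex i) B PB)
    maximal : eval F p ≡ eval F (combo n a A) × eval F q ≡ eval F (combo n a A)
    maximal = average-of-max 0<t t<1 (decomposition-≤ dp F A (below Pp)) (decomposition-≤ dq F A (below Pq))
      (trans (resp F split) (lin F t p (1ℚ - t) q))

  -- The two implications of the theorem.

  []∈sublists : ∀ {X : Set} (xs : List X) → [] ∈ sublists xs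
  []∈sublists [] = here refl
  []∈sublists (x ∷ xs) = ∈-++⁺ʳ (map (x ∷_) (sublists xs)) ([]∈sublists xs)

  []∈antichains : ∀ n i → [] ∈ antichains n i
  []∈antichains n i = ∈-filter⁺ (antichainIn? n i) ([]∈sublists (allPairs n)) ([] , λ _ _ ())

  -- All coordinates occur among the functionals, which makes the lexicographic maximum unique.
  lexMax-nice : ∀ n (F : Functional n) A → (∀ i → A i ∈ antichains n i) →
    (∀ i → LexMax (F ∷ map (coordF n) (allPairs n)) (_∈ antichains n i) (A i)) → Nice n A
  lexMax-nice n F A A∈ lex = tuple , λ a _ → combo-InP a A tuple , λ p q t p∈P q∈P 0<t t<1 split i j v →
    let dp = decompose p∈P
        dq = decompose q∈P
        eqs = lexMax-rigid (F ∷ map (coordF n) (allPairs n)) lex dp dq (members dp) (members dq) 0<t t<1 split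
    in trans (sym (coordF-eval v p)) (trans (All.lookup eqs (there (∈-map⁺ (coordF n) (∈-allPairs⁺ v)))) (coordF-eval v q))
    where
    tuple : AntichainTuple n A
    tuple i _ _ = proj₂ (∈-filter⁻ (antichainIn? n i) {xs = sublists (allPairs n)} (A∈ i))

  -- The functional `F` attains its maximum on the polytope only at `v`. Exchanging the pieces of
  -- `v` for the `A i` does not lower `F`, so the resulting point is `v` itself.
  vertex⇒nice : ∀ {a v} → IsVertex n a v → ∃ λ A → Nice n A × v ≈[ n ] combo n a A
  vertex⇒nice {n} {a} {v} vertex@(v∈P , _) =
    A , nice , proj₂ exposing (combo n a A) (combo-InP a A (proj₁ nice))
      (decomposition-≤ dv F A (All.map (λ {(i , B)} B∈ → proj₁ (lex i) B B∈) (members dv)))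
    where
    exposing = vertex⇒exposed vertex
    F = proj₁ exposing
    dv = decompose v∈P
    Fs = F ∷ map (coordF n) (allPairs n)
    A : ℕ → List Pair
    -- The empty antichain guarantees that there is a candidate.
    A i = proj₁ (lexMax Fs (antichains n i) ([]∈antichains n i))
    lex : ∀ i → LexMax Fs (_∈ antichains n i) (A i)
    lex i = proj₂ (proj₂ (lexMax Fs (antichains n i) ([]∈antichains n i)))
    nice : Nice n A
    nice = lexMax-nice n F A (λ i → proj₁ (proj₂ (lexMax Fs (antichains n i) ([]∈antichains n i)))) lex

  -- Translating by Σ χ_{A_i} embeds P_λ into P_{λ+ρ}, where niceness applies.
  nice⇒vertex : ∀ {a v A} → Nice n A → v ≈[ n ] combo n a A → IsVertex n a v
  nice⇒vertex {n} {a} {v} {A} (tuple , vertices) v≈ =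
    InP-resp (λ i j ij → sym (v≈ i j ij)) (combo-InP a A tuple) ,
    λ p q t p∈ q∈ 0<t t<1 split i j ij → ∙-cancelʳ (ρ i j) (p i j) (q i j)
      (proj₂ (vertices (λ i → a i ℕ.+ 1) (λ i _ _ → ℕₚ.m≤n+m 1 (a i)))
      (λ i j → p i j + ρ i j) (λ i j → q i j + ρ i j) t (InP-+ p∈ ρ∈) (InP-+ q∈ ρ∈) 0<t t<1
      (λ k l kl → trans (combo-+ n a (λ _ → 1) A k l)
        (trans (cong (_+ ρ k l) (trans (sym (v≈ k l kl)) (split k l kl))) (shift t (p k l) (q k l) (ρ k l)))) i j ij)
    where
    ρ : Point
    ρ = combo n (λ _ → 1) A
    ρ∈ = combo-InP (λ _ → 1) A tuple
    open +-*-Solver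
    shift : ∀ t p q r → (t * p + (1ℚ - t) * q) + r ≡ t * (p + r) + (1ℚ - t) * (q + r)
    shift = solve 4 (λ t p q r → (t :* p :+ (con 1ℚ :- t) :* q) :+ r := t :* (p :+ r) :+ (con 1ℚ :- t) :* (q :+ r)) refl

open import Data.Nat using (ℕ; _≤_; _∸_)
open import Data.Product using (∃; _×_; _,_)
open import Relation.Binary.PropositionalEquality using (_≡_)
open import Function.Bundles using (_⇔_; mk⇔)
open import Data.List using (List)
open Vertices using (vertex⇒nice; nice⇒vertex)

theorem2p7 : (n : ℕ) → 2 ≤ n → (a : ℕ → ℕ) →
    (∃ λ i → 1 ≤ i × i ≤ n ∸ 1 × a i ≡ 0) →
    (v : Point) →
    IsVertex n a v ⇔ (∃ λ (A : ℕ → List Pair) → Nice n A × v ≈[ n ] combo n a A)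
theorem2p7 n _ a _ v = mk⇔ vertex⇒nice λ (A , nice , v≈) → nice⇒vertex {A = A} nice v≈
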